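{- For every integer $k\ge 4$, every positive integer $n$ is a sum of $k$ nonzero generalized pentagonal numbers, except for $n=1,2,\ldots,k-1$.
   Context: A generalized pentagonal number is a number of the form $P_5(x)=\frac{3x^2-x}{2}$ with $x\in\mathbb{Z}$; it is nonzero iff $x\neq 0$. -}

module Defs where

open import Data.Integer using (ℤ; +_; _+_; _*_; _-_)
open import Data.Integer.DivMod using (_/ℕ_)
open import Data.Nat using (ℕ)
open import Data.Vec using (Vec; map; foldr′)
open import Data.Vec.Relation.Unary.All using (All)
open import Data.Product using (Σ; _×_)
open import Relation.Binary.PropositionalEquality using (_≡_)
open import Relation.Nullary using (¬_)

-- generalized pentagonal number P5(x) = (3x^2 - x)/2  (the division is exact)
P5 : ℤ → ℤ
P5 x = ((+ 3) * x * x - x) /ℕ 2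

sumℤ : ∀ {k} → Vec ℤ k → ℤ
sumℤ = foldr′ _+_ (+ 0)

SumOfNonzeroGenPent : ℕ → ℤ → Set
SumOfNonzeroGenPent k n =
  Σ (Vec ℤ k) λ xs → All (λ x → ¬ (x ≡ + 0)) xs × (n ≡ sumℤ (map P5 xs))

{-# OPTIONS --safe #-}
module Submission where

-- Adding the summand P5(1) = 1 reduces the existence part to k = 4; the other part holds because nonzero
-- generalized pentagonal numbers are at least 1.
--
-- Write 6 n + 1 = a² + b² + c² + d² by Lagrange.  For a suitable choice of signs the numbers a + b + c + d,
-- a + b - c - d, a - b + c - d, a - b - c + d are coprime to 6, and their squares add up to 24 n + 4 =
-- Σ (6 tᵢ - 1)².  Hence n = Σ P5(tᵢ), where some tᵢ may still vanish.
--
-- Zeros are removed by rational orthogonal transformations of the vector (6 tᵢ - 1)ᵢ with denominator 2, 3, 5, ...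
-- that happen to be integral on a residue class of t.  The new indices t′ᵢ are affine functions of the old ones,
-- so the transformation fails only where some t′ᵢ vanishes, which is a family with one parameter less.  Starting
-- from the 3-parameter family (0, a, b, c), finitely many transformations leave only numbers n ≤ 28.

open import Defs
open import Data.Nat using (ℕ; _≤_; _<_)
open import Data.Integer using (+_)
open import Relation.Nullary using (¬_)
open import Data.Product using (_×_)
open import Data.Empty using (⊥; ⊥-elim)
open import Data.Fin using (Fin; zero; suc; toℕ; fromℕ<; splitAt; join)
import Data.Fin.Properties as Fin
open import Data.Integer as ℤ using (ℤ; -[1+_]; _+_; _*_; _-_; -_; 0ℤ; 1ℤ; ∣_∣)
import Data.Integer.Divisibility.Signed as Signed
open import Data.Integer.DivMod using (_/ℕ_; _%ℕ_; a≡a%ℕn+[a/ℕn]*n; n%ℕd<d)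
import Data.Integer.Properties as ℤ
open import Data.Integer.Tactic.RingSolver using (solve-∀)
open import Data.Nat as ℕ using (zero; suc; s≤s; z≤n; z<s; s<s)
import Data.Nat.Divisibility as ℕ
open import Data.Nat.Induction using (<-wellFounded; Acc; acc; <-rec)
open import Data.Nat.Primality using (Prime; prime?; composite; euclidsLemma; ¬prime[1]; prime⇒irreducible; ¬prime⇒composite)
import Data.Nat.Properties as ℕ
import Data.Nat.Tactic.RingSolver as ℕ-Solver
open import Data.Product using (Σ; ∃; ∃₂; _,_; proj₁; proj₂)
import Data.Product.Properties as Product
open import Data.Sum using (_⊎_; inj₁; inj₂; [_,_]′)
open import Data.Unit using (⊤; tt)
open import Data.Vec using (Vec; []; _∷_; map; zipWith; lookup; replicate; _[_]%=_)
import Data.Vec.Properties as Vec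
open import Data.Vec.Relation.Unary.All using (All; []; _∷_; all?)
open import Relation.Binary using (DecidableEquality; tri<; tri≈; tri>)
open import Relation.Binary.PropositionalEquality using (_≡_; refl; sym; trans; cong; cong₂; subst; subst₂; module ≡-Reasoning)
open import Relation.Nullary using (yes; no; ¬?)
open import Relation.Nullary.Decidable using (True; toWitness; from-no)

open ≡-Reasoning

-- Lagrange's four squares theorem

-- An index `t` is zero exactly when `(6 t - 1)² = 1`, and Lagrange's theorem gives no control over
-- this; hence zeros are removed afterwards. A transformed vector is of use only if its entries are
-- integers coprime to 6, for then each is `6 t′ - 1` up to sign. The reflection of three
-- coordinates along (1, 1, 1) has the new entries `6 tᵢ + 1 - 4 s`, where `s` is the sum of the
-- three indices, so it can be used iff `s` is not 1 modulo 3. The reflection of all four along (1,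
-- 1, 1, 1) has the new entries `6 tᵢ + 1 - 3 s`, so there `s` must be even. These conditions
-- account for many splits modulo 3 and 2; classes that escape them need denominators such as 5, 6,
-- 9 or 10.
--
-- That a transformation preserves the sum is an identity between quadratic polynomials in the
-- parameters, so comparing coefficients proves it. Vanishing of a new index is one linear equation,
-- and on its solutions the sum is that of a family with fewer parameters. Without parameters a
-- single value remains, which is below 4 or has explicit nonzero indices.

∑² : (a b c d : ℤ) → ℤ
∑² a b c d = a * a + b * b + c * c + d * d

record FourSquares (N : ℤ) : Set where
  constructor fourSquares
  field
    a b c d : ℤ
    sum     : N ≡ ∑² a b c d

-- Multiplicativity of the quaternion norm: the witnesses are the components of `(x, y, z, w)` times
-- the conjugate of `(a, b, c, d)`.
FourSquares-* : ∀ {M N} → FourSquares M → FourSquares N → FourSquares (M * N)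
FourSquares-* (fourSquares a b c d refl) (fourSquares x y z w refl) =
  fourSquares (a * x + b * y + c * z + d * w) (a * y - b * x + c * w - d * z)
              (a * z - b * w - c * x + d * y) (a * w + b * z - c * y - d * x) (euler a b c d x y z w)
  where
  euler : ∀ a b c d x y z w → (a * a + b * b + c * c + d * d) * (x * x + y * y + z * z + w * w) ≡
    (a * x + b * y + c * z + d * w) * (a * x + b * y + c * z + d * w) +
    (a * y - b * x + c * w - d * z) * (a * y - b * x + c * w - d * z) +
    (a * z - b * w - c * x + d * y) * (a * z - b * w - c * x + d * y) +
    (a * w + b * z - c * y - d * x) * (a * w + b * z - c * y - d * x)
  euler = solve-∀

-- Residues of least absolute value

-- The boundary case is kept apart, with positive sign only, because the descent needs strict
-- inequality in one coordinate and treats four exact halves separately.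
Bounded : ℤ → ℕ → Set
Bounded y m = ∣ y ∣ ℕ.+ ∣ y ∣ ℕ.< m ⊎ y + y ≡ + m

record LeastResidue (x : ℤ) (m : ℕ) : Set where
  constructor leastResidue
  field
    y k   : ℤ
    x≡    : x ≡ y + + m * k
    bound : Bounded y m

private
  from-quotient : ∀ r q m → r + q * m ≡ r + m * q
  from-quotient = solve-∀

  from-next-quotient : ∀ r q m → r + q * m ≡ r - m + m * (q + 1ℤ)
  from-next-quotient = solve-∀

least-residue : ∀ x m .{{_ : ℕ.NonZero m}} → LeastResidue x m
least-residue x m with ℕ.<-cmp (x %ℕ m ℕ.+ x %ℕ m) m
... | tri< r+r<m _ _ = leastResidue (+ (x %ℕ m)) (x /ℕ m)
  (trans (a≡a%ℕn+[a/ℕn]*n x m) (from-quotient (+ (x %ℕ m)) (x /ℕ m) (+ m))) (inj₁ r+r<m)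
... | tri≈ _ r+r≡m _ = leastResidue (+ (x %ℕ m)) (x /ℕ m)
  (trans (a≡a%ℕn+[a/ℕn]*n x m) (from-quotient (+ (x %ℕ m)) (x /ℕ m) (+ m))) (inj₂ (cong +_ r+r≡m))
... | tri> _ _ m<r+r = leastResidue (+ r - + m) (x /ℕ m + 1ℤ)
  (trans (a≡a%ℕn+[a/ℕn]*n x m) (from-next-quotient (+ r) (x /ℕ m) (+ m)))
  (inj₁ (subst (λ s → s ℕ.+ s ℕ.< m) (sym abs-eq) s+s<m))
  where
  r = x %ℕ m
  r<m : r ℕ.< m
  r<m = n%ℕd<d x m
  s = m ℕ.∸ r
  abs-eq : ∣ + r - + m ∣ ≡ s
  abs-eq = trans (cong ∣_∣ (ℤ.m-n≡m⊖n r m)) (ℤ.∣⊖∣-< r<m)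
  s+r≡m : s ℕ.+ r ≡ m
  s+r≡m = ℕ.m∸n+n≡m (ℕ.<⇒≤ r<m)
  s<r : s ℕ.< r
  s<r = ℕ.+-cancelʳ-< r s r (subst (ℕ._< r ℕ.+ r) (sym s+r≡m) m<r+r)
  s+s<m : s ℕ.+ s ℕ.< m
  s+s<m = subst (s ℕ.+ s ℕ.<_) s+r≡m (ℕ.+-monoʳ-< s s<r)

bound⇒≤ : ∀ {y m} → Bounded y m → ∣ y ∣ ℕ.+ ∣ y ∣ ℕ.≤ m
bound⇒≤ (inj₁ lt) = ℕ.<⇒≤ lt
bound⇒≤ {+ n} (inj₂ eq) = ℕ.≤-reflexive (ℤ.+-injective eq)

square-∣∣ : ∀ y → y * y ≡ + (∣ y ∣ ℕ.* ∣ y ∣)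
square-∣∣ (+ n) = sym (ℤ.pos-* n n)
square-∣∣ -[1+ n ] = refl

∑²-∣∣ : ∀ a b c d → ∑² a b c d ≡
  + (∣ a ∣ ℕ.* ∣ a ∣ ℕ.+ ∣ b ∣ ℕ.* ∣ b ∣ ℕ.+ ∣ c ∣ ℕ.* ∣ c ∣ ℕ.+ ∣ d ∣ ℕ.* ∣ d ∣)
∑²-∣∣ a b c d = cong₂ _+_ (cong₂ _+_ (cong₂ _+_ (square-∣∣ a) (square-∣∣ b)) (square-∣∣ c)) (square-∣∣ d)

nonneg-factor : ∀ m {n} R .{{_ : ℕ.NonZero m}} → + n ≡ + m * R → ∃ λ r → R ≡ + r × n ≡ m ℕ.* r
nonneg-factor m (+ r) eq = r , refl , ℤ.+-injective (trans eq (sym (ℤ.pos-* m r)))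
nonneg-factor (suc m) -[1+ r ] ()

double² : ℕ → ℕ
double² n = (n ℕ.+ n) ℕ.* (n ℕ.+ n)

-- Everything is scaled by 4, since the residues are bounded through their doubles and `m` may be
-- odd.
∑²<4m²⇒r<m : ∀ a b c d {m r} → a ℕ.* a ℕ.+ b ℕ.* b ℕ.+ c ℕ.* c ℕ.+ d ℕ.* d ≡ m ℕ.* r →
  double² a ℕ.+ (double² b ℕ.+ (double² c ℕ.+ double² d)) ℕ.< m ℕ.* m ℕ.+ (m ℕ.* m ℕ.+ (m ℕ.* m ℕ.+ m ℕ.* m)) →
  r ℕ.< m
∑²<4m²⇒r<m a b c d {m} {r} eq lt = ℕ.*-cancelˡ-< m r m (ℕ.*-cancelˡ-< 4 (m ℕ.* r) (m ℕ.* m)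
  (subst₂ ℕ._<_ (trans (sym (quadruple a b c d)) (cong (4 ℕ.*_) eq)) (sym (4m² m)) lt))
  where
  quadruple : ∀ a b c d → 4 ℕ.* (a ℕ.* a ℕ.+ b ℕ.* b ℕ.+ c ℕ.* c ℕ.+ d ℕ.* d) ≡
    (a ℕ.+ a) ℕ.* (a ℕ.+ a) ℕ.+ ((b ℕ.+ b) ℕ.* (b ℕ.+ b) ℕ.+ ((c ℕ.+ c) ℕ.* (c ℕ.+ c) ℕ.+ (d ℕ.+ d) ℕ.* (d ℕ.+ d)))
  quadruple = ℕ-Solver.solve-∀
  4m² : ∀ m → 4 ℕ.* (m ℕ.* m) ≡ m ℕ.* m ℕ.+ (m ℕ.* m ℕ.+ (m ℕ.* m ℕ.+ m ℕ.* m))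
  4m² = ℕ-Solver.solve-∀

∣∧1<m<p⇒⊥ : ∀ {m p} → Prime p → 1 ℕ.< m → m ℕ.< p → ∀ z → + p ≡ z * + m → ⊥
∣∧1<m<p⇒⊥ pr 1<m m<p z eq with prime⇒irreducible pr (Signed.∣⇒∣ᵤ (Signed.divides z eq))
... | inj₁ refl = ℕ.<-irrefl refl 1<m
... | inj₂ refl = ℕ.<-irrefl refl m<p

-- Descent step: from a representation of `m p` to one of `r p` with `0 < r < m`

module Descent {p m : ℕ} (pr : Prime p) (1<m : 1 ℕ.< m) (m<p : m ℕ.< p)
               {x₁ x₂ x₃ x₄ : ℤ} (sum : + m * + p ≡ ∑² x₁ x₂ x₃ x₄)
               (res₁ : LeastResidue x₁ m) (res₂ : LeastResidue x₂ m)
               (res₃ : LeastResidue x₃ m) (res₄ : LeastResidue x₄ m) where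

  instance
    m≢0 : ℕ.NonZero m
    m≢0 = ℕ.>-nonZero (ℕ.<-trans z<s 1<m)

  open LeastResidue res₁ renaming (y to y₁; k to k₁; x≡ to x₁≡; bound to bound₁)
  open LeastResidue res₂ renaming (y to y₂; k to k₂; x≡ to x₂≡; bound to bound₂)
  open LeastResidue res₃ renaming (y to y₃; k to k₃; x≡ to x₃≡; bound to bound₃)
  open LeastResidue res₄ renaming (y to y₄; k to k₄; x≡ to x₄≡; bound to bound₄)

  K Y S R : ℤ
  K = ∑² k₁ k₂ k₃ k₄
  Y = ∑² y₁ y₂ y₃ y₄
  S = k₁ * (y₁ + y₁) + k₂ * (y₂ + y₂) + k₃ * (y₃ + y₃) + k₄ * (y₄ + y₄)
  -- Expanding the squares of `y + m k` gives `m p = Y + m S + m² K`. So `R` is the quotient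
  -- `Y / m`, obtained here without a division.
  R = + p - S - K * + m

  p≡ : + p ≡ R + S + K * + m
  p≡ = rearrange (+ p) S (K * + m)
    where
    rearrange : ∀ p s t → p ≡ p - s - t + s + t
    rearrange = solve-∀

  Y≡mR : Y ≡ + m * R
  Y≡mR = sym (begin
    + m * R                                           ≡⟨ ℤ-expand (+ m) (+ p) S K ⟩
    + m * + p - + m * (S + K * + m)                   ≡⟨ cong (_- + m * (S + K * + m)) sum′ ⟩
    ∑² (y₁ + + m * k₁) (y₂ + + m * k₂) (y₃ + + m * k₃) (y₄ + + m * k₄) - + m * (S + K * + m)
      ≡⟨ collect (+ m) y₁ y₂ y₃ y₄ k₁ k₂ k₃ k₄ ⟩
    Y                                                 ∎)
    where
    ℤ-expand : ∀ m p s k → m * (p - s - k * m) ≡ m * p - m * (s + k * m)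
    ℤ-expand = solve-∀
    sum′ : + m * + p ≡ ∑² (y₁ + + m * k₁) (y₂ + + m * k₂) (y₃ + + m * k₃) (y₄ + + m * k₄)
    sum′ = trans sum (cong₂ _+_ (cong₂ _+_ (cong₂ _+_ (cong (λ x → x * x) x₁≡) (cong (λ x → x * x) x₂≡))
      (cong (λ x → x * x) x₃≡)) (cong (λ x → x * x) x₄≡))
    collect : ∀ m a b c d e f g h →
      (a + m * e) * (a + m * e) + (b + m * f) * (b + m * f) + (c + m * g) * (c + m * g) + (d + m * h) * (d + m * h)
      - m * (e * (a + a) + f * (b + b) + g * (c + c) + h * (d + d) + (e * e + f * f + g * g + h * h) * m)
      ≡ a * a + b * b + c * c + d * d
    collect = solve-∀

  private
    r-data = nonneg-factor m R (trans (sym (∑²-∣∣ y₁ y₂ y₃ y₄)) Y≡mR)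

  r : ℕ
  r = proj₁ r-data

  R≡r : R ≡ + r
  R≡r = proj₁ (proj₂ r-data)

  ∑∣y∣²≡mr : ∣ y₁ ∣ ℕ.* ∣ y₁ ∣ ℕ.+ ∣ y₂ ∣ ℕ.* ∣ y₂ ∣ ℕ.+ ∣ y₃ ∣ ℕ.* ∣ y₃ ∣ ℕ.+ ∣ y₄ ∣ ℕ.* ∣ y₄ ∣ ≡ m ℕ.* r
  ∑∣y∣²≡mr = proj₂ (proj₂ r-data)

  -- The product of the quaternions x and ȳ is divisible by m; these are its components divided by m.
  rp : FourSquares (+ r * + p)
  rp = subst (λ z → FourSquares (z * + p)) R≡r (fourSquares
    (R + k₁ * y₁ + k₂ * y₂ + k₃ * y₃ + k₄ * y₄) (k₁ * y₂ - k₂ * y₁ + k₃ * y₄ - k₄ * y₃)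
    (k₁ * y₃ - k₂ * y₄ - k₃ * y₁ + k₄ * y₂) (k₁ * y₄ + k₂ * y₃ - k₃ * y₂ - k₄ * y₁) (begin
    R * + p                          ≡⟨ cong (R *_) p≡ ⟩
    R * (R + S + K * + m)            ≡⟨ expand R S K (+ m) ⟩
    R * R + R * S + K * (+ m * R)    ≡⟨ cong (λ z → R * R + R * S + K * z) Y≡mR ⟨
    R * R + R * S + K * Y            ≡⟨ collect R k₁ k₂ k₃ k₄ y₁ y₂ y₃ y₄ ⟩
    _                                ∎))
    where
    expand : ∀ r s k m → r * (r + s + k * m) ≡ r * r + r * s + k * (m * r)
    expand = solve-∀
    collect : ∀ r a b c d x y z w →
      r * r + r * (a * (x + x) + b * (y + y) + c * (z + z) + d * (w + w)) +
      (a * a + b * b + c * c + d * d) * (x * x + y * y + z * z + w * w) ≡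
      (r + a * x + b * y + c * z + d * w) * (r + a * x + b * y + c * z + d * w) +
      (a * y - b * x + c * w - d * z) * (a * y - b * x + c * w - d * z) +
      (a * z - b * w - c * x + d * y) * (a * z - b * w - c * x + d * y) +
      (a * w + b * z - c * y - d * x) * (a * w + b * z - c * y - d * x)
    collect = solve-∀

  -- If `r` were zero, all residues `y` would vanish, so `m` would divide every `x`, and `p = K m`
  -- would contradict primality.
  r≢0 : ¬ r ≡ 0
  r≢0 r≡0 = ∣∧1<m<p⇒⊥ pr 1<m m<p K (begin
    + p                 ≡⟨ p≡ ⟩
    R + S + K * + m     ≡⟨ cong₂ (λ u v → u + v + K * + m) (trans R≡r (cong +_ r≡0)) S≡0 ⟩
    0ℤ + 0ℤ + K * + m   ≡⟨ ℤ.+-identityˡ _ ⟩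
    K * + m             ∎)
    where
    total≡0 : ∣ y₁ ∣ ℕ.* ∣ y₁ ∣ ℕ.+ ∣ y₂ ∣ ℕ.* ∣ y₂ ∣ ℕ.+ ∣ y₃ ∣ ℕ.* ∣ y₃ ∣ ℕ.+ ∣ y₄ ∣ ℕ.* ∣ y₄ ∣ ≡ 0
    total≡0 = trans ∑∣y∣²≡mr (trans (cong (m ℕ.*_) r≡0) (ℕ.*-zeroʳ m))
    root : ∀ y → ∣ y ∣ ℕ.* ∣ y ∣ ≡ 0 → y ≡ 0ℤ
    root y eq = ℤ.∣i∣≡0⇒i≡0 ([ (λ z → z) , (λ z → z) ]′ (ℕ.m*n≡0⇒m≡0∨n≡0 ∣ y ∣ eq))
    t₃ = ℕ.m+n≡0⇒m≡0 _ total≡0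
    t₂ = ℕ.m+n≡0⇒m≡0 _ t₃
    vanish : ∀ k {y} → y ≡ 0ℤ → k * (y + y) ≡ 0ℤ
    vanish k refl = ℤ.*-zeroʳ k
    S≡0 : S ≡ 0ℤ
    S≡0 = cong₂ _+_ (cong₂ _+_ (cong₂ _+_
      (vanish k₁ (root y₁ (ℕ.m+n≡0⇒m≡0 _ t₂)))
      (vanish k₂ (root y₂ (ℕ.m+n≡0⇒n≡0 _ t₂))))
      (vanish k₃ (root y₃ (ℕ.m+n≡0⇒n≡0 _ t₃))))
      (vanish k₄ (root y₄ (ℕ.m+n≡0⇒n≡0 _ total≡0)))

  private
    ≤m² : ∀ y → Bounded y m → double² ∣ y ∣ ℕ.≤ m ℕ.* m
    ≤m² y b = ℕ.*-mono-≤ (bound⇒≤ {y} b) (bound⇒≤ {y} b)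

    <m² : ∀ y → ∣ y ∣ ℕ.+ ∣ y ∣ ℕ.< m → double² ∣ y ∣ ℕ.< m ℕ.* m
    <m² _ b = ℕ.*-mono-< b b

    strict : double² ∣ y₁ ∣ ℕ.+ (double² ∣ y₂ ∣ ℕ.+ (double² ∣ y₃ ∣ ℕ.+ double² ∣ y₄ ∣)) ℕ.<
             m ℕ.* m ℕ.+ (m ℕ.* m ℕ.+ (m ℕ.* m ℕ.+ m ℕ.* m)) → r ℕ.< m
    strict = ∑²<4m²⇒r<m (∣ y₁ ∣) (∣ y₂ ∣) (∣ y₃ ∣) (∣ y₄ ∣) ∑∣y∣²≡mr

    -- The only case without a strict bound. Here `R = m` and `S` is a multiple of `m`, so `m`
    -- divides `p = R + S + K m`.
    all-halves⇒⊥ : y₁ + y₁ ≡ + m → y₂ + y₂ ≡ + m → y₃ + y₃ ≡ + m → y₄ + y₄ ≡ + m → ⊥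
    all-halves⇒⊥ e₁ e₂ e₃ e₄ = ∣∧1<m<p⇒⊥ pr 1<m m<p (1ℤ + (k₁ + k₂ + k₃ + k₄) + K) (begin
      + p                                             ≡⟨ p≡ ⟩
      R + S + K * + m                                 ≡⟨ cong₂ (λ u v → u + v + K * + m) R≡m S≡ ⟩
      + m + (k₁ * + m + k₂ * + m + k₃ * + m + k₄ * + m) + K * + m ≡⟨ factor (+ m) k₁ k₂ k₃ k₄ K ⟩
      (1ℤ + (k₁ + k₂ + k₃ + k₄) + K) * + m            ∎)
      where
      factor : ∀ m a b c d k → m + (a * m + b * m + c * m + d * m) + k * m ≡ (1ℤ + (a + b + c + d) + k) * m
      factor = solve-∀
      S≡ : S ≡ k₁ * + m + k₂ * + m + k₃ * + m + k₄ * + m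
      S≡ = cong₂ _+_ (cong₂ _+_ (cong₂ _+_ (cong (k₁ *_) e₁) (cong (k₂ *_) e₂)) (cong (k₃ *_) e₃)) (cong (k₄ *_) e₄)
      double : ∀ a b c d → + 4 * (a * a + b * b + c * c + d * d) ≡
        (a + a) * (a + a) + (b + b) * (b + b) + (c + c) * (c + c) + (d + d) * (d + d)
      double = solve-∀
      4m² : ∀ m → m * m + m * m + m * m + m * m ≡ + 4 * (m * m)
      4m² = solve-∀
      R≡m : R ≡ + m
      R≡m = ℤ.*-cancelˡ-≡ (+ m) R (+ m) (ℤ.*-cancelˡ-≡ (+ 4) _ _ (begin
        + 4 * (+ m * R)   ≡⟨ cong (+ 4 *_) Y≡mR ⟨
        + 4 * Y           ≡⟨ double y₁ y₂ y₃ y₄ ⟩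
        ∑² (y₁ + y₁) (y₂ + y₂) (y₃ + y₃) (y₄ + y₄)
          ≡⟨ cong₂ _+_ (cong₂ _+_ (cong₂ _+_ (cong (λ z → z * z) e₁) (cong (λ z → z * z) e₂)) (cong (λ z → z * z) e₃)) (cong (λ z → z * z) e₄) ⟩
        ∑² (+ m) (+ m) (+ m) (+ m) ≡⟨ 4m² (+ m) ⟩
        + 4 * (+ m * + m) ∎))

    from-bounds : Bounded y₁ m → Bounded y₂ m → Bounded y₃ m → Bounded y₄ m → r ℕ.< m
    from-bounds (inj₁ b₁) b₂ b₃ b₄ = strict
      (ℕ.+-mono-<-≤ (<m² y₁ b₁) (ℕ.+-mono-≤ (≤m² y₂ b₂) (ℕ.+-mono-≤ (≤m² y₃ b₃) (≤m² y₄ b₄))))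
    from-bounds b₁ (inj₁ b₂) b₃ b₄ = strict
      (ℕ.+-mono-≤-< (≤m² y₁ b₁) (ℕ.+-mono-<-≤ (<m² y₂ b₂) (ℕ.+-mono-≤ (≤m² y₃ b₃) (≤m² y₄ b₄))))
    from-bounds b₁ b₂ (inj₁ b₃) b₄ = strict
      (ℕ.+-mono-≤-< (≤m² y₁ b₁) (ℕ.+-mono-≤-< (≤m² y₂ b₂) (ℕ.+-mono-<-≤ (<m² y₃ b₃) (≤m² y₄ b₄))))
    from-bounds b₁ b₂ b₃ (inj₁ b₄) = strict
      (ℕ.+-mono-≤-< (≤m² y₁ b₁) (ℕ.+-mono-≤-< (≤m² y₂ b₂) (ℕ.+-mono-≤-< (≤m² y₃ b₃) (<m² y₄ b₄))))
    from-bounds (inj₂ e₁) (inj₂ e₂) (inj₂ e₃) (inj₂ e₄) = ⊥-elim (all-halves⇒⊥ e₁ e₂ e₃ e₄)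

  r<m : r ℕ.< m
  r<m = from-bounds bound₁ bound₂ bound₃ bound₄

descent : ∀ {p} → Prime p → ∀ m → Acc ℕ._<_ m → 0 ℕ.< m → m ℕ.< p →
          FourSquares (+ m * + p) → FourSquares (+ p)
descent {p} pr 1 _ _ _ sq = subst FourSquares (ℤ.*-identityˡ (+ p)) sq
descent pr (suc (suc m)) (acc rs) _ m<p (fourSquares x₁ x₂ x₃ x₄ sum) =
  descent pr r (rs r<m) (ℕ.n≢0⇒n>0 r≢0) (ℕ.<-trans r<m m<p) rp
  where open Descent pr (s<s z<s) m<p sum
          (least-residue x₁ _) (least-residue x₂ _) (least-residue x₃ _) (least-residue x₄ _)

-- Odd primes: a small multiple that is a sum of four squares

residue : ∀ p .{{_ : ℕ.NonZero p}} → ℤ → Fin p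
residue p z = fromℕ< (n%ℕd<d z p)

residue-≡⇒∣ : ∀ p .{{_ : ℕ.NonZero p}} z w → residue p z ≡ residue p w → + p Signed.∣ z - w
residue-≡⇒∣ p z w eq = Signed.divides (z /ℕ p - w /ℕ p) (begin
  z - w                           ≡⟨ cong₂ _-_ (a≡a%ℕn+[a/ℕn]*n z p) (a≡a%ℕn+[a/ℕn]*n w p) ⟩
  (+ (z %ℕ p) + z /ℕ p * + p) - (+ (w %ℕ p) + w /ℕ p * + p)
    ≡⟨ cong (λ r → (+ (z %ℕ p) + z /ℕ p * + p) - (+ r + w /ℕ p * + p)) (sym r-eq) ⟩
  (+ (z %ℕ p) + z /ℕ p * + p) - (+ (z %ℕ p) + w /ℕ p * + p)
    ≡⟨ collect (+ (z %ℕ p)) (z /ℕ p) (w /ℕ p) (+ p) ⟩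
  (z /ℕ p - w /ℕ p) * + p         ∎)
  where
  collect : ∀ r u v p → (r + u * p) - (r + v * p) ≡ (u - v) * p
  collect = solve-∀
  r-eq : z %ℕ p ≡ w %ℕ p
  r-eq = trans (sym (Fin.toℕ-fromℕ< (n%ℕd<d z p))) (trans (cong toℕ eq) (Fin.toℕ-fromℕ< (n%ℕd<d w p)))

∣∧<⇒≡0 : ∀ {p n} → p ℕ.∣ n → n ℕ.< p → n ≡ 0
∣∧<⇒≡0 {n = zero} _ _ = refl
∣∧<⇒≡0 {n = suc n} p∣n n<p = ⊥-elim (ℕ.>⇒∤ n<p p∣n)

module _ (h : ℕ) (pr : Prime (suc (h ℕ.+ h))) where

  private
    p : ℕ
    p = suc (h ℕ.+ h)

  -- The prime divides `a - b` or `a + b`. Both have absolute value at most `2 h < p`, so the one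
  -- divided is zero; if it is `a + b`, then both numbers are zero.
  squares-distinct : ∀ {a b} → a ℕ.≤ h → b ℕ.≤ h → + p Signed.∣ + a * + a - + b * + b → a ≡ b
  squares-distinct {a} {b} a≤h b≤h p∣ with euclidsLemma ∣ + a - + b ∣ (a ℕ.+ b) pr p∣product
    where
    factor : ∀ x y → x * x - y * y ≡ (x - y) * (x + y)
    factor = solve-∀
    p∣product : p ℕ.∣ ∣ + a - + b ∣ ℕ.* (a ℕ.+ b)
    p∣product = subst (p ℕ.∣_) (trans (cong ∣_∣ (factor (+ a) (+ b))) (ℤ.abs-* (+ a - + b) (+ a + + b)))
      (Signed.∣⇒∣ᵤ p∣)
  ... | inj₁ p∣a-b = ℤ.+-injective (ℤ.i-j≡0⇒i≡j (+ a) (+ b)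
    (ℤ.∣i∣≡0⇒i≡0 (∣∧<⇒≡0 p∣a-b (s≤s (ℕ.≤-trans (ℤ.∣i-j∣≤∣i∣+∣j∣ (+ a) (+ b)) (ℕ.+-mono-≤ a≤h b≤h))))))
  ... | inj₂ p∣a+b = trans (ℕ.m+n≡0⇒m≡0 a a+b≡0) (sym (ℕ.m+n≡0⇒n≡0 a a+b≡0))
    where
    a+b≡0 : a ℕ.+ b ≡ 0
    a+b≡0 = ∣∧<⇒≡0 p∣a+b (s≤s (ℕ.+-mono-≤ a≤h b≤h))

  private
    candidate : Fin (suc h) ⊎ Fin (suc h) → ℤ
    candidate (inj₁ a) = + toℕ a * + toℕ a
    candidate (inj₂ b) = - (1ℤ + + toℕ b * + toℕ b)

    ≤h : (i : Fin (suc h)) → toℕ i ℕ.≤ h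
    ≤h i = ℕ.≤-pred (Fin.toℕ<n i)

    Solution : Set
    Solution = ∃₂ λ a b → a ℕ.≤ h × b ℕ.≤ h × p ℕ.∣ a ℕ.* a ℕ.+ b ℕ.* b ℕ.+ 1

    solution : ∀ a b → a ℕ.≤ h → b ℕ.≤ h → + p Signed.∣ + a * + a + + b * + b + 1ℤ → Solution
    solution a b a≤h b≤h p∣ = a , b , a≤h , b≤h ,
      subst (p ℕ.∣_) (cong ∣_∣ (cong₂ (λ x y → x + y + 1ℤ) (square-∣∣ (+ a)) (square-∣∣ (+ b)))) (Signed.∣⇒∣ᵤ p∣)

    collision : ∀ s t → ¬ s ≡ t → residue p (candidate s) ≡ residue p (candidate t) → Solution
    collision (inj₁ a) (inj₁ b) s≢t eq = ⊥-elim (s≢t (cong inj₁ (Fin.toℕ-injective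
      (squares-distinct (≤h a) (≤h b) (residue-≡⇒∣ p (candidate (inj₁ a)) (candidate (inj₁ b)) eq)))))
    collision (inj₂ a) (inj₂ b) s≢t eq = ⊥-elim (s≢t (cong inj₂ (Fin.toℕ-injective (sym
      (squares-distinct (≤h b) (≤h a) (subst (+ p Signed.∣_) (cancel (+ toℕ a) (+ toℕ b)) (residue-≡⇒∣ p (candidate (inj₂ a)) (candidate (inj₂ b)) eq)))))))
      where
      cancel : ∀ x y → - (1ℤ + x * x) - - (1ℤ + y * y) ≡ y * y - x * x
      cancel = solve-∀
    collision (inj₁ a) (inj₂ b) s≢t eq = solution (toℕ a) (toℕ b) (≤h a) (≤h b)
      (subst (+ p Signed.∣_) (cancel (+ toℕ a) (+ toℕ b)) (residue-≡⇒∣ p (candidate (inj₁ a)) (candidate (inj₂ b)) eq))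
      where
      cancel : ∀ x y → x * x - - (1ℤ + y * y) ≡ x * x + y * y + 1ℤ
      cancel = solve-∀
    collision (inj₂ b) (inj₁ a) s≢t eq = collision (inj₁ a) (inj₂ b) (λ ()) (sym eq)

  -- The h + 1 residues a² and the h + 1 residues -(1 + b²) cannot all differ modulo 2 h + 1.
  p∣a²+b²+1 : ∃₂ λ a b → a ℕ.≤ h × b ℕ.≤ h × p ℕ.∣ a ℕ.* a ℕ.+ b ℕ.* b ℕ.+ 1
  p∣a²+b²+1 with Fin.pigeonhole p<2h+2 (λ i → residue p (candidate (splitAt (suc h) i)))
    where
    p<2h+2 : p ℕ.< suc h ℕ.+ suc h
    p<2h+2 = ℕ.≤-reflexive (cong suc (sym (ℕ.+-suc h h)))
  ... | i , j , i<j , eq = collision (splitAt (suc h) i) (splitAt (suc h) j)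
    (λ s≡t → Fin.<-irrefl (begin
      i                                    ≡⟨ Fin.join-splitAt (suc h) (suc h) i ⟨
      join (suc h) (suc h) (splitAt (suc h) i) ≡⟨ cong (join (suc h) (suc h)) s≡t ⟩
      join (suc h) (suc h) (splitAt (suc h) j) ≡⟨ Fin.join-splitAt (suc h) (suc h) j ⟩
      j                                    ∎) i<j) eq

  odd-prime-fourSquares : 0 ℕ.< h → FourSquares (+ p)
  odd-prime-fourSquares 0<h with p∣a²+b²+1
  ... | a , b , a≤h , b≤h , ℕ.divides m eq = descent pr m (<-wellFounded m) 0<m m<p
    (fourSquares (+ a) (+ b) 1ℤ 0ℤ (begin
      + m * + p                             ≡⟨ ℤ.pos-* m p ⟨
      + (m ℕ.* p)                           ≡⟨ cong +_ eq ⟨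
      + (a ℕ.* a ℕ.+ b ℕ.* b ℕ.+ 1)         ≡⟨ cong₂ (λ x y → x + y + 1ℤ) (ℤ.pos-* a a) (ℤ.pos-* b b) ⟩
      + a * + a + + b * + b + 1ℤ            ≡⟨ ℤ.+-identityʳ _ ⟨
      + a * + a + + b * + b + 1ℤ + 0ℤ       ∎))
    where
    0<m : 0 ℕ.< m
    0<m = ℕ.n≢0⇒n>0 λ { refl → ℕ.1+n≢0 (trans (ℕ.+-comm 1 _) eq) }
    -- The bracket is the excess of `p²` over `2 h² + 1`. It is positive for `0 < h`, whence
    -- `m p = a² + b² + 1 < p²`.
    expand : ∀ h → suc (h ℕ.+ h) ℕ.* suc (h ℕ.+ h) ≡ h ℕ.* h ℕ.+ h ℕ.* h ℕ.+ 1 ℕ.+ (h ℕ.+ (3 ℕ.* h ℕ.+ 2 ℕ.* (h ℕ.* h)))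
    expand = ℕ-Solver.solve-∀
    m<p : m ℕ.< p
    m<p = ℕ.*-cancelʳ-< p m p (subst₂ ℕ._<_ eq (sym (expand h)) (ℕ.≤-<-trans
      (ℕ.+-monoˡ-≤ 1 (ℕ.+-mono-≤ (ℕ.*-mono-≤ a≤h a≤h) (ℕ.*-mono-≤ b≤h b≤h)))
      (ℕ.m<m+n _ (ℕ.≤-trans 0<h (ℕ.m≤m+n h _)))))

-- From odd primes to all positive integers

half : ∀ n → ∃ λ h → n ≡ h ℕ.+ h ⊎ n ≡ suc (h ℕ.+ h)
half zero = 0 , inj₁ refl
half (suc n) with half n
... | h , inj₁ refl = h , inj₂ refl
... | h , inj₂ refl = suc h , inj₁ (cong suc (sym (ℕ.+-suc h h)))

prime-fourSquares : ∀ {p} → Prime p → FourSquares (+ p)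
prime-fourSquares {p} pr with half p
... | zero , inj₂ refl = ⊥-elim (¬prime[1] pr)
... | suc h , inj₂ refl = odd-prime-fourSquares (suc h) pr z<s
... | h , inj₁ refl with prime⇒irreducible pr (ℕ.divides h (trans (cong (h ℕ.+_) (sym (ℕ.+-identityʳ h))) (ℕ.*-comm 2 h)))
...   | inj₂ 2≡p = subst (λ q → FourSquares (+ q)) 2≡p (fourSquares 1ℤ 1ℤ 0ℤ 0ℤ refl)

lagrange : ∀ n → .{{_ : ℕ.NonZero n}} → FourSquares (+ n)
lagrange n = <-rec (λ n → .{{_ : ℕ.NonZero n}} → FourSquares (+ n)) step n
  where
  step : ∀ n → (∀ {m} → m ℕ.< n → .{{_ : ℕ.NonZero m}} → FourSquares (+ m)) →
         .{{_ : ℕ.NonZero n}} → FourSquares (+ n)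
  step 1 rec = fourSquares 1ℤ 0ℤ 0ℤ 0ℤ refl
  step n@(suc (suc _)) rec with prime? n
  ... | yes pr = prime-fourSquares pr
  ... | no ¬pr with ¬prime⇒composite ¬pr
  ...   | composite {d} d<n (ℕ.divides q eq) = subst FourSquares (trans (sym (ℤ.pos-* q d)) (cong +_ (sym eq)))
    (FourSquares-* (rec q<n {{q≢0}}) (rec d<n {{d≢0}}))
    where
    qd≢0 : ℕ.NonZero (q ℕ.* d)
    qd≢0 = subst ℕ.NonZero eq _
    q≢0 : ℕ.NonZero q
    q≢0 = ℕ.m*n≢0⇒m≢0 q {{qd≢0}}
    d≢0 : ℕ.NonZero d
    d≢0 = ℕ.m*n≢0⇒n≢0 q {{qd≢0}}
    q<n : q ℕ.< n
    q<n = subst (q ℕ.<_) (sym eq) (ℕ.m<m*n q d {{q≢0}} (ℕ.nonTrivial⇒n>1 d))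

-- Sums of four generalized pentagonal numbers

private
  variable
    d e n : ℕ

-- Twice the pentagonal number of index t.
pent₂ : ℤ → ℤ
pent₂ t = t * (+ 3 * t - 1ℤ)

Σpent₂ : Vec ℤ n → ℤ
Σpent₂ [] = 0ℤ
Σpent₂ (t ∷ ts) = pent₂ t + Σpent₂ ts

-- A square has the parity of its root, so the parity of `a + b + c + d` can be read off from the
-- sum of the squares. The same fact makes the division in `P5` exact.
pronic-even : ∀ a → ∃ λ T → a * a - a ≡ T + T
pronic-even a with a %ℕ 2 | a /ℕ 2 | a≡a%ℕn+[a/ℕn]*n a 2 | n%ℕd<d a 2
... | 0 | q | refl | _ = q * (+ 2 * q - 1ℤ) , even q
  where
  even : ∀ q → (0ℤ + q * + 2) * (0ℤ + q * + 2) - (0ℤ + q * + 2) ≡ q * (+ 2 * q - 1ℤ) + q * (+ 2 * q - 1ℤ)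
  even = solve-∀
... | 1 | q | refl | _ = q * (+ 2 * q + 1ℤ) , odd q
  where
  odd : ∀ q → (1ℤ + q * + 2) * (1ℤ + q * + 2) - (1ℤ + q * + 2) ≡ q * (+ 2 * q + 1ℤ) + q * (+ 2 * q + 1ℤ)
  odd = solve-∀
... | suc (suc _) | _ | _ | s≤s (s≤s ())

data ZeroOne : ℤ → Set where
  zero : ZeroOne 0ℤ
  one  : ZeroOne 1ℤ

-- Changing the sign of a makes its residue modulo 3 zero or one.
record Normalised (a : ℤ) : Set where
  constructor normalised
  field
    {ε}     : ℤ
    a′ q    : ℤ
    square  : a * a ≡ a′ * a′
    a′≡     : a′ ≡ ε + + 3 * q
    zeroOne : ZeroOne ε

normalise : ∀ a → Normalised a
normalise a with a %ℕ 3 | a /ℕ 3 | a≡a%ℕn+[a/ℕn]*n a 3 | n%ℕd<d a 3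
... | 0 | q | eq | _ = normalised a q refl (trans eq (cong (λ z → 0ℤ + z) (ℤ.*-comm q (+ 3)))) zero
... | 1 | q | eq | _ = normalised a q refl (trans eq (cong (λ z → 1ℤ + z) (ℤ.*-comm q (+ 3)))) one
... | 2 | q | refl | _ = normalised (1ℤ + + 3 * (- q - 1ℤ)) (- q - 1ℤ) (square q) refl one
  where
  square : ∀ q → (+ 2 + q * + 3) * (+ 2 + q * + 3) ≡ (1ℤ + + 3 * (- q - 1ℤ)) * (1ℤ + + 3 * (- q - 1ℤ))
  square = solve-∀
... | suc (suc (suc _)) | _ | _ | s≤s (s≤s (s≤s ()))

-- Representatives of the units modulo 3, left unreduced: these are the values taken by the signed
-- sums of residues in `signs`.
data Unit₃ : ℤ → Set where
  plus1  : Unit₃ 1ℤ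
  minus1 : Unit₃ (- 1ℤ)
  plus2  : Unit₃ (+ 2)
  minus2 : Unit₃ (- + 2)

-- z = 3 z - 2 z is determined modulo 6 by its residues modulo 2 and 3.
mod-6 : ∀ {z} ε u v → z ≡ 1ℤ + + 2 * u → z ≡ ε + + 3 * v → z ≡ + 3 - + 2 * ε + + 6 * (u - v)
mod-6 {z} ε u v z≡₂ z≡₃ = begin
  z                                            ≡⟨ difference z ⟩
  + 3 * z - + 2 * z                            ≡⟨ cong₂ (λ x y → + 3 * x - + 2 * y) z≡₂ z≡₃ ⟩
  + 3 * (1ℤ + + 2 * u) - + 2 * (ε + + 3 * v)   ≡⟨ collect u v ε ⟩
  + 3 - + 2 * ε + + 6 * (u - v)                ∎
  where
  difference : ∀ z → z ≡ + 3 * z - + 2 * z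
  difference = solve-∀
  collect : ∀ u v ε → + 3 * (1ℤ + + 2 * u) - + 2 * (ε + + 3 * v) ≡ + 3 - + 2 * ε + + 6 * (u - v)
  collect = solve-∀

-- An odd `z` prime to 3 is 1 or -1 modulo 6, so `z` or `-z` has the form `6 t - 1`; squaring
-- removes the sign.
coprime-to-6 : ∀ {z ε} u v → Unit₃ ε → z ≡ 1ℤ + + 2 * u → z ≡ ε + + 3 * v →
  ∃ λ t → z * z ≡ (+ 6 * t - 1ℤ) * (+ 6 * t - 1ℤ)
coprime-to-6 u v plus1 z≡₂ z≡₃ = - (u - v) , trans (cong (λ z → z * z) (mod-6 1ℤ u v z≡₂ z≡₃)) (eq (u - v))
  where
  eq : ∀ w → (+ 3 - + 2 * 1ℤ + + 6 * w) * (+ 3 - + 2 * 1ℤ + + 6 * w) ≡ (+ 6 * (- w) - 1ℤ) * (+ 6 * (- w) - 1ℤ)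
  eq = solve-∀
coprime-to-6 u v minus1 z≡₂ z≡₃ = u - v + 1ℤ , trans (cong (λ z → z * z) (mod-6 (- 1ℤ) u v z≡₂ z≡₃)) (eq (u - v))
  where
  eq : ∀ w → (+ 3 - + 2 * (- 1ℤ) + + 6 * w) * (+ 3 - + 2 * (- 1ℤ) + + 6 * w) ≡ (+ 6 * (w + 1ℤ) - 1ℤ) * (+ 6 * (w + 1ℤ) - 1ℤ)
  eq = solve-∀
coprime-to-6 u v plus2 z≡₂ z≡₃ = u - v , trans (cong (λ z → z * z) (mod-6 (+ 2) u v z≡₂ z≡₃)) (eq (u - v))
  where
  eq : ∀ w → (+ 3 - + 2 * + 2 + + 6 * w) * (+ 3 - + 2 * + 2 + + 6 * w) ≡ (+ 6 * w - 1ℤ) * (+ 6 * w - 1ℤ)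
  eq = solve-∀
coprime-to-6 u v minus2 z≡₂ z≡₃ = - (u - v) - 1ℤ , trans (cong (λ z → z * z) (mod-6 (- + 2) u v z≡₂ z≡₃)) (eq (u - v))
  where
  eq : ∀ w → (+ 3 - + 2 * (- + 2) + + 6 * w) * (+ 3 - + 2 * (- + 2) + + 6 * w) ≡ (+ 6 * (- w - 1ℤ) - 1ℤ) * (+ 6 * (- w - 1ℤ) - 1ℤ)
  eq = solve-∀

record AllUnits (e₁ e₂ e₃ e₄ : ℤ) : Set where
  constructor allUnits
  field
    unit₁ : Unit₃ (e₁ + e₂ + e₃ + e₄)
    unit₂ : Unit₃ (e₁ + e₂ - e₃ - e₄)
    unit₃ : Unit₃ (e₁ - e₂ + e₃ - e₄)
    unit₄ : Unit₃ (e₁ - e₂ - e₃ + e₄)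

-- The number of ones is 1 modulo 3, hence one or four. A single one makes all signed sums 1 or -1.
-- Four ones would give 4, 0, 0, 0, but negating one of them gives 2, -2, -2, -2.
signs : ∀ {e₁ e₂ e₃ e₄} → ZeroOne e₁ → ZeroOne e₂ → ZeroOne e₃ → ZeroOne e₄ →
  + 3 Signed.∣ ∑² e₁ e₂ e₃ e₄ - 1ℤ → AllUnits e₁ e₂ e₃ e₄ ⊎ AllUnits (- e₁) e₂ e₃ e₄
signs one  zero zero zero _ = inj₁ (allUnits plus1 plus1 plus1 plus1)
signs zero one  zero zero _ = inj₁ (allUnits plus1 plus1 minus1 minus1)
signs zero zero one  zero _ = inj₁ (allUnits plus1 minus1 plus1 minus1)
signs zero zero zero one  _ = inj₁ (allUnits plus1 minus1 minus1 plus1)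
signs one  one  one  one  _ = inj₂ (allUnits plus2 minus2 minus2 minus2)
signs zero zero zero zero 3∣ = ⊥-elim (from-no (+ 3 Signed.∣? - 1ℤ) 3∣)
signs one  one  zero zero 3∣ = ⊥-elim (from-no (+ 3 Signed.∣? + 1) 3∣)
signs one  zero one  zero 3∣ = ⊥-elim (from-no (+ 3 Signed.∣? + 1) 3∣)
signs one  zero zero one  3∣ = ⊥-elim (from-no (+ 3 Signed.∣? + 1) 3∣)
signs zero one  one  zero 3∣ = ⊥-elim (from-no (+ 3 Signed.∣? + 1) 3∣)
signs zero one  zero one  3∣ = ⊥-elim (from-no (+ 3 Signed.∣? + 1) 3∣)
signs zero zero one  one  3∣ = ⊥-elim (from-no (+ 3 Signed.∣? + 1) 3∣)
signs one  one  one  zero 3∣ = ⊥-elim (from-no (+ 3 Signed.∣? + 2) 3∣)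
signs one  one  zero one  3∣ = ⊥-elim (from-no (+ 3 Signed.∣? + 2) 3∣)
signs one  zero one  one  3∣ = ⊥-elim (from-no (+ 3 Signed.∣? + 2) 3∣)
signs zero one  one  one  3∣ = ⊥-elim (from-no (+ 3 Signed.∣? + 2) 3∣)

pentagonal-sum : ∀ {n a b c d e₁ e₂ e₃ e₄ q₁ q₂ q₃ q₄} → ∑² a b c d ≡ 1ℤ + + 6 * n →
  a ≡ e₁ + + 3 * q₁ → b ≡ e₂ + + 3 * q₂ → c ≡ e₃ + + 3 * q₃ → d ≡ e₄ + + 3 * q₄ →
  AllUnits e₁ e₂ e₃ e₄ → ∃ λ (ts : Vec ℤ 4) → n + n ≡ Σpent₂ ts
pentagonal-sum {n} {a} {b} {c} {d} {e₁} {e₂} {e₃} {e₄} {q₁} {q₂} {q₃} {q₄} sum a≡ b≡ c≡ d≡ (allUnits unit₁ unit₂ unit₃ unit₄)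
  with pronic-even a | pronic-even b | pronic-even c | pronic-even d
... | A , A≡ | B , B≡ | C , C≡ | D , D≡
  with coprime-to-6 u (q₁ + q₂ + q₃ + q₄) unit₁ odd₁ mod₁
     | coprime-to-6 (u - (c + d)) (q₁ + q₂ - q₃ - q₄) unit₂ odd₂ mod₂
     | coprime-to-6 (u - (b + d)) (q₁ - q₂ + q₃ - q₄) unit₃ odd₃ mod₃
     | coprime-to-6 (u - (b + c)) (q₁ - q₂ - q₃ + q₄) unit₄ odd₄ mod₄
  where
  -- The sum `a + b + c + d` equals the sum of squares `1 + 6 n` minus the even numbers `a² - a`,
  -- ..., `d² - d`. The other three signed sums differ from it by even numbers.
  u = + 3 * n - (A + B + C + D)
  odd₁ : a + b + c + d ≡ 1ℤ + + 2 * u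
  odd₁ = begin
    a + b + c + d
      ≡⟨ regroup a b c d ⟩
    ∑² a b c d - (a * a - a + (b * b - b) + (c * c - c) + (d * d - d))
      ≡⟨ cong₂ _-_ sum (cong₂ _+_ (cong₂ _+_ (cong₂ _+_ A≡ B≡) C≡) D≡) ⟩
    1ℤ + + 6 * n - (A + A + (B + B) + (C + C) + (D + D))
      ≡⟨ collect n A B C D ⟩
    1ℤ + + 2 * u ∎
    where
    regroup : ∀ a b c d → a + b + c + d ≡
      a * a + b * b + c * c + d * d - (a * a - a + (b * b - b) + (c * c - c) + (d * d - d))
    regroup = solve-∀
    collect : ∀ n A B C D → 1ℤ + + 6 * n - (A + A + (B + B) + (C + C) + (D + D)) ≡
      1ℤ + + 2 * (+ 3 * n - (A + B + C + D))
    collect = solve-∀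
  shift : ∀ {z} y → z ≡ a + b + c + d - + 2 * y → z ≡ 1ℤ + + 2 * (u - y)
  shift y eq = trans eq (trans (cong (_- + 2 * y) odd₁) (collect u y))
    where
    collect : ∀ u y → 1ℤ + + 2 * u - + 2 * y ≡ 1ℤ + + 2 * (u - y)
    collect = solve-∀
  odd₂ : a + b - c - d ≡ 1ℤ + + 2 * (u - (c + d))
  odd₂ = shift (c + d) (eq a b c d)
    where
    eq : ∀ a b c d → a + b - c - d ≡ a + b + c + d - + 2 * (c + d)
    eq = solve-∀
  odd₃ : a - b + c - d ≡ 1ℤ + + 2 * (u - (b + d))
  odd₃ = shift (b + d) (eq a b c d)
    where
    eq : ∀ a b c d → a - b + c - d ≡ a + b + c + d - + 2 * (b + d)
    eq = solve-∀
  odd₄ : a - b - c + d ≡ 1ℤ + + 2 * (u - (b + c))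
  odd₄ = shift (b + c) (eq a b c d)
    where
    eq : ∀ a b c d → a - b - c + d ≡ a + b + c + d - + 2 * (b + c)
    eq = solve-∀
  mod₁ : a + b + c + d ≡ e₁ + e₂ + e₃ + e₄ + + 3 * (q₁ + q₂ + q₃ + q₄)
  mod₁ rewrite a≡ | b≡ | c≡ | d≡ = eq e₁ e₂ e₃ e₄ q₁ q₂ q₃ q₄
    where
    eq : ∀ a b c d x y z w → a + + 3 * x + (b + + 3 * y) + (c + + 3 * z) + (d + + 3 * w) ≡ a + b + c + d + + 3 * (x + y + z + w)
    eq = solve-∀
  mod₂ : a + b - c - d ≡ e₁ + e₂ - e₃ - e₄ + + 3 * (q₁ + q₂ - q₃ - q₄)
  mod₂ rewrite a≡ | b≡ | c≡ | d≡ = eq e₁ e₂ e₃ e₄ q₁ q₂ q₃ q₄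
    where
    eq : ∀ a b c d x y z w → a + + 3 * x + (b + + 3 * y) - (c + + 3 * z) - (d + + 3 * w) ≡ a + b - c - d + + 3 * (x + y - z - w)
    eq = solve-∀
  mod₃ : a - b + c - d ≡ e₁ - e₂ + e₃ - e₄ + + 3 * (q₁ - q₂ + q₃ - q₄)
  mod₃ rewrite a≡ | b≡ | c≡ | d≡ = eq e₁ e₂ e₃ e₄ q₁ q₂ q₃ q₄
    where
    eq : ∀ a b c d x y z w → a + + 3 * x - (b + + 3 * y) + (c + + 3 * z) - (d + + 3 * w) ≡ a - b + c - d + + 3 * (x - y + z - w)
    eq = solve-∀
  mod₄ : a - b - c + d ≡ e₁ - e₂ - e₃ + e₄ + + 3 * (q₁ - q₂ - q₃ + q₄)
  mod₄ rewrite a≡ | b≡ | c≡ | d≡ = eq e₁ e₂ e₃ e₄ q₁ q₂ q₃ q₄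
    where
    eq : ∀ a b c d x y z w → a + + 3 * x - (b + + 3 * y) - (c + + 3 * z) + (d + + 3 * w) ≡ a - b - c + d + + 3 * (x - y - z + w)
    eq = solve-∀
... | t₁ , sq₁ | t₂ , sq₂ | t₃ , sq₃ | t₄ , sq₄ =
  -- The factor 12 completes the square: `12 * pent₂ t = (6 t - 1)² - 1`.
  t₁ ∷ t₂ ∷ t₃ ∷ t₄ ∷ [] , ℤ.*-cancelˡ-≡ (+ 12) (n + n) _ (begin
    + 12 * (n + n)                       ≡⟨ twelve n ⟩
    + 4 * (1ℤ + + 6 * n) - + 4           ≡⟨ cong (λ N → + 4 * N - + 4) sum ⟨
    + 4 * ∑² a b c d - + 4               ≡⟨ cong (_- + 4) (parallelogram a b c d) ⟩
    ∑² (a + b + c + d) (a + b - c - d) (a - b + c - d) (a - b - c + d) - + 4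
      ≡⟨ cong (_- + 4) (cong₂ _+_ (cong₂ _+_ (cong₂ _+_ sq₁ sq₂) sq₃) sq₄) ⟩
    ∑² (+ 6 * t₁ - 1ℤ) (+ 6 * t₂ - 1ℤ) (+ 6 * t₃ - 1ℤ) (+ 6 * t₄ - 1ℤ) - + 4
      ≡⟨ complete-squares t₁ t₂ t₃ t₄ ⟩
    + 12 * Σpent₂ (t₁ ∷ t₂ ∷ t₃ ∷ t₄ ∷ []) ∎)
  where
  twelve : ∀ n → + 12 * (n + n) ≡ + 4 * (1ℤ + + 6 * n) - + 4
  twelve = solve-∀
  parallelogram : ∀ a b c d → + 4 * (a * a + b * b + c * c + d * d) ≡
    (a + b + c + d) * (a + b + c + d) + (a + b - c - d) * (a + b - c - d) +
    (a - b + c - d) * (a - b + c - d) + (a - b - c + d) * (a - b - c + d)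
  parallelogram = solve-∀
  complete-squares : ∀ x y z w →
    (+ 6 * x - 1ℤ) * (+ 6 * x - 1ℤ) + (+ 6 * y - 1ℤ) * (+ 6 * y - 1ℤ) +
    (+ 6 * z - 1ℤ) * (+ 6 * z - 1ℤ) + (+ 6 * w - 1ℤ) * (+ 6 * w - 1ℤ) - + 4 ≡
    + 12 * (x * (+ 3 * x - 1ℤ) + (y * (+ 3 * y - 1ℤ) + (z * (+ 3 * z - 1ℤ) + (w * (+ 3 * w - 1ℤ) + 0ℤ))))
  complete-squares = solve-∀

sum-of-four : ∀ n → ∃ λ (ts : Vec ℤ 4) → + n + + n ≡ Σpent₂ ts
sum-of-four n with lagrange (suc (6 ℕ.* n))
... | fourSquares a b c d N≡ with normalise a | normalise b | normalise c | normalise d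
... | normalised {e₁} a′ q₁ a² a≡ z₁ | normalised {e₂} b′ q₂ b² b≡ z₂
    | normalised {e₃} c′ q₃ c² c≡ z₃ | normalised {e₄} d′ q₄ d² d≡ z₄ =
  [ pentagonal-sum {+ n} sum a≡ b≡ c≡ d≡
  , pentagonal-sum {+ n} (trans (cong (λ z → z + b′ * b′ + c′ * c′ + d′ * d′) (neg-square a′)) sum)
      (trans (cong -_ a≡) (neg-residue e₁ q₁)) b≡ c≡ d≡
  ]′ (signs z₁ z₂ z₃ z₄ 3∣)
  where
  sum : ∑² a′ b′ c′ d′ ≡ 1ℤ + + 6 * + n
  sum = begin
    ∑² a′ b′ c′ d′      ≡⟨ cong₂ _+_ (cong₂ _+_ (cong₂ _+_ a² b²) c²) d² ⟨
    ∑² a b c d          ≡⟨ N≡ ⟨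
    + suc (6 ℕ.* n)     ≡⟨ cong (λ z → 1ℤ + z) (ℤ.pos-* 6 n) ⟩
    1ℤ + + 6 * + n      ∎
  neg-square : ∀ a → - a * - a ≡ a * a
  neg-square = solve-∀
  neg-residue : ∀ e q → - (e + + 3 * q) ≡ - e + + 3 * (- q)
  neg-residue = solve-∀
  excess : ℤ → ℤ → ℤ
  excess e q = + 2 * e * q + + 3 * q * q
  X : ℤ
  X = excess e₁ q₁ + excess e₂ q₂ + excess e₃ q₃ + excess e₄ q₄
  square-residue : ∀ {a} e q → a ≡ e + + 3 * q → e * e ≡ a * a - + 3 * excess e q
  square-residue e q refl = expand e q
    where
    expand : ∀ e q → e * e ≡ (e + + 3 * q) * (e + + 3 * q) - + 3 * (+ 2 * e * q + + 3 * q * q)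
    expand = solve-∀
  -- Modulo 3 each normalised root is its residue, and `1 + 6 n` is 1.
  3∣ : + 3 Signed.∣ ∑² e₁ e₂ e₃ e₄ - 1ℤ
  3∣ = Signed.divides (+ 2 * + n - X) (begin
    ∑² e₁ e₂ e₃ e₄ - 1ℤ
      ≡⟨ cong (_- 1ℤ) (cong₂ _+_ (cong₂ _+_ (cong₂ _+_ (square-residue e₁ q₁ a≡) (square-residue e₂ q₂ b≡)) (square-residue e₃ q₃ c≡)) (square-residue e₄ q₄ d≡)) ⟩
    a′ * a′ - + 3 * excess e₁ q₁ + (b′ * b′ - + 3 * excess e₂ q₂) + (c′ * c′ - + 3 * excess e₃ q₃) + (d′ * d′ - + 3 * excess e₄ q₄) - 1ℤ
      ≡⟨ regroup (a′ * a′) (b′ * b′) (c′ * c′) (d′ * d′) (excess e₁ q₁) (excess e₂ q₂) (excess e₃ q₃) (excess e₄ q₄) ⟩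
    ∑² a′ b′ c′ d′ - + 3 * X - 1ℤ
      ≡⟨ cong (λ N → N - + 3 * X - 1ℤ) sum ⟩
    1ℤ + + 6 * + n - + 3 * X - 1ℤ
      ≡⟨ factor (+ n) X ⟩
    (+ 2 * + n - X) * + 3 ∎)
    where
    regroup : ∀ a b c d x y z w → a - + 3 * x + (b - + 3 * y) + (c - + 3 * z) + (d - + 3 * w) - 1ℤ ≡
      a + b + c + d - + 3 * (x + y + z + w) - 1ℤ
    regroup = solve-∀
    factor : ∀ n x → 1ℤ + + 6 * n - + 3 * x - 1ℤ ≡ (+ 2 * n - x) * + 3
    factor = solve-∀

-- Linear and quadratic forms with integer coefficients

Form : ℕ → Set
Form = Vec ℤ

infix 4 _≟_
infixl 6 _⊕_ _⊞_
infixr 7 _⊙_ _⊡_ _⊗_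

⟦_⟧ : Form n → Vec ℤ n → ℤ
⟦ [] ⟧ [] = 0ℤ
⟦ a ∷ f ⟧ (x ∷ xs) = a * x + ⟦ f ⟧ xs

_⊕_ : Form n → Form n → Form n
_⊕_ = zipWith _+_

_⊙_ : ℤ → Form n → Form n
c ⊙ f = map (c *_) f

⟦⟧-zero : ∀ n (xs : Vec ℤ n) → ⟦ replicate n 0ℤ ⟧ xs ≡ 0ℤ
⟦⟧-zero zero [] = refl
⟦⟧-zero (suc n) (x ∷ xs) = trans (ℤ.+-identityˡ _) (⟦⟧-zero n xs)

⟦⟧-⊕ : (f g : Form n) (xs : Vec ℤ n) → ⟦ f ⊕ g ⟧ xs ≡ ⟦ f ⟧ xs + ⟦ g ⟧ xs
⟦⟧-⊕ [] [] [] = refl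
⟦⟧-⊕ (a ∷ f) (b ∷ g) (x ∷ xs) rewrite ⟦⟧-⊕ f g xs = rearrange a b x (⟦ f ⟧ xs) (⟦ g ⟧ xs)
  where
  rearrange : ∀ a b x u v → (a + b) * x + (u + v) ≡ a * x + u + (b * x + v)
  rearrange = solve-∀

⟦⟧-⊙ : ∀ c (f : Form n) (xs : Vec ℤ n) → ⟦ c ⊙ f ⟧ xs ≡ c * ⟦ f ⟧ xs
⟦⟧-⊙ c [] [] = sym (ℤ.*-zeroʳ c)
⟦⟧-⊙ c (a ∷ f) (x ∷ xs) rewrite ⟦⟧-⊙ c f xs = rearrange c a x (⟦ f ⟧ xs)
  where
  rearrange : ∀ c a x u → c * a * x + c * u ≡ c * (a * x + u)
  rearrange = solve-∀

-- A quadratic form is stored as its upper triangular coefficient matrix.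
Quad : ℕ → Set
Quad zero = ⊤
Quad (suc n) = Form (suc n) × Quad n

⟪_⟫ : Quad n → Vec ℤ n → ℤ
⟪_⟫ {zero} _ [] = 0ℤ
⟪_⟫ {suc n} (f , q) (x ∷ xs) = x * ⟦ f ⟧ (x ∷ xs) + ⟪ q ⟫ xs

-- Evaluating this on closed coefficients proves the polynomial identities behind all
-- transformations below.
_≟_ : DecidableEquality (Quad n)
_≟_ {zero} _ _ = yes refl
_≟_ {suc n} = Product.≡-dec (Vec.≡-dec ℤ._≟_) _≟_

_⊞_ : Quad n → Quad n → Quad n
_⊞_ {zero} _ _ = tt
_⊞_ {suc n} (f , q) (g , r) = (f ⊕ g) , (q ⊞ r)

_⊡_ : ℤ → Quad n → Quad n
_⊡_ {zero} c _ = tt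
_⊡_ {suc n} c (f , q) = (c ⊙ f) , (c ⊡ q)

_⊗_ : Form n → Form n → Quad n
[] ⊗ [] = tt
(a ∷ f) ⊗ (b ∷ g) = (a * b ∷ a ⊙ g ⊕ b ⊙ f) , f ⊗ g

⟪⟫-⊞ : (q r : Quad n) (xs : Vec ℤ n) → ⟪ q ⊞ r ⟫ xs ≡ ⟪ q ⟫ xs + ⟪ r ⟫ xs
⟪⟫-⊞ {zero} _ _ [] = refl
⟪⟫-⊞ {suc n} (f , q) (g , r) (x ∷ xs)
  rewrite ⟦⟧-⊕ f g (x ∷ xs) | ⟪⟫-⊞ q r xs =
  rearrange x (⟦ f ⟧ (x ∷ xs)) (⟦ g ⟧ (x ∷ xs)) (⟪ q ⟫ xs) (⟪ r ⟫ xs)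
  where
  rearrange : ∀ x u v q r → x * (u + v) + (q + r) ≡ x * u + q + (x * v + r)
  rearrange = solve-∀

⟪⟫-⊡ : ∀ c (q : Quad n) (xs : Vec ℤ n) → ⟪ c ⊡ q ⟫ xs ≡ c * ⟪ q ⟫ xs
⟪⟫-⊡ {zero} c _ [] = sym (ℤ.*-zeroʳ c)
⟪⟫-⊡ {suc n} c (f , q) (x ∷ xs) rewrite ⟦⟧-⊙ c f (x ∷ xs) | ⟪⟫-⊡ c q xs =
  rearrange c x (⟦ f ⟧ (x ∷ xs)) (⟪ q ⟫ xs)
  where
  rearrange : ∀ c x u q → x * (c * u) + c * q ≡ c * (x * u + q)
  rearrange = solve-∀

⟪⟫-⊗ : (f g : Form n) (xs : Vec ℤ n) → ⟪ f ⊗ g ⟫ xs ≡ ⟦ f ⟧ xs * ⟦ g ⟧ xs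
⟪⟫-⊗ [] [] [] = refl
⟪⟫-⊗ (a ∷ f) (b ∷ g) (x ∷ xs)
  rewrite ⟦⟧-⊕ (a ⊙ g) (b ⊙ f) xs | ⟦⟧-⊙ a g xs | ⟦⟧-⊙ b f xs | ⟪⟫-⊗ f g xs =
  rearrange a b x (⟦ f ⟧ xs) (⟦ g ⟧ xs)
  where
  rearrange : ∀ a b x u v → x * (a * b * x + (a * v + b * u)) + u * v ≡ (a * x + u) * (b * x + v)
  rearrange = solve-∀

infixl 8 _◃_

_◃_ : Form n → Vec (Form e) n → Form e
_◃_ {e = e} [] [] = replicate e 0ℤ
(a ∷ f) ◃ (h ∷ hs) = a ⊙ h ⊕ f ◃ hs

⟦⟧-◃ : (f : Form n) (hs : Vec (Form e) n) (xs : Vec ℤ e) →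
        ⟦ f ◃ hs ⟧ xs ≡ ⟦ f ⟧ (map (λ h → ⟦ h ⟧ xs) hs)
⟦⟧-◃ [] [] xs = ⟦⟧-zero _ xs
⟦⟧-◃ (a ∷ f) (h ∷ hs) xs
  rewrite ⟦⟧-⊕ (a ⊙ h) (f ◃ hs) xs | ⟦⟧-⊙ a h xs | ⟦⟧-◃ f hs xs = refl

-- Affine families of indices

-- N is twice the number to be represented, which is required to be at least 4.
Represented : ℤ → Set
Represented N = + 8 ℤ.≤ N → Σ (Vec ℤ 4) λ ts → All (λ t → ¬ t ≡ 0ℤ) ts × N ≡ Σpent₂ ts

-- Affine forms in d parameters are linear forms in 1 and the parameters, constant term first.
Affine : ℕ → Set
Affine d = Form (suc d)

Family : ℕ → Set
Family d = Vec (Affine d) 4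

const : ℤ → Affine d
const {d} c = c ∷ replicate d 0ℤ

infix 9 _at_

_at_ : Vec (Affine d) n → Vec ℤ d → Vec ℤ n
F at p = map (λ f → ⟦ f ⟧ (1ℤ ∷ p)) F

⟦const⟧ : ∀ c (p : Vec ℤ d) → ⟦ const c ⟧ (1ℤ ∷ p) ≡ c
⟦const⟧ c p rewrite ⟦⟧-zero _ p = trans (ℤ.+-identityʳ _) (ℤ.*-identityʳ c)

-- Homogenising with the coordinate 1 turns `t (3 t - 1)` into a product of two linear forms, so
-- `Σpent₂` of a family becomes a quadratic form. The product of two zero forms serves as the zero
-- quadratic form.
norm : Vec (Affine d) n → Quad (suc d)
norm [] = replicate _ 0ℤ ⊗ replicate _ 0ℤ
norm (f ∷ F) = f ⊗ ((+ 3) ⊙ f ⊕ const (- 1ℤ)) ⊞ norm F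

⟪norm⟫ : (F : Vec (Affine d) n) (p : Vec ℤ d) → ⟪ norm F ⟫ (1ℤ ∷ p) ≡ Σpent₂ (F at p)
⟪norm⟫ {d} [] p = trans (⟪⟫-⊗ (replicate (suc d) 0ℤ) (replicate (suc d) 0ℤ) (1ℤ ∷ p))
  (cong (λ z → z * z) (⟦⟧-zero (suc d) (1ℤ ∷ p)))
⟪norm⟫ (f ∷ F) p = begin
  ⟪ f ⊗ g ⊞ norm F ⟫ x              ≡⟨ ⟪⟫-⊞ (f ⊗ g) (norm F) x ⟩
  ⟪ f ⊗ g ⟫ x + ⟪ norm F ⟫ x        ≡⟨ cong₂ _+_ (⟪⟫-⊗ f g x) (⟪norm⟫ F p) ⟩
  ⟦ f ⟧ x * ⟦ g ⟧ x + Σpent₂ (F at p) ≡⟨ cong (λ y → ⟦ f ⟧ x * y + Σpent₂ (F at p)) eval-g ⟩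
  pent₂ (⟦ f ⟧ x) + Σpent₂ (F at p) ∎
  where
  x = 1ℤ ∷ p
  g = (+ 3) ⊙ f ⊕ const (- 1ℤ)
  eval-g : ⟦ g ⟧ x ≡ + 3 * ⟦ f ⟧ x - 1ℤ
  eval-g = trans (⟦⟧-⊕ ((+ 3) ⊙ f) (const (- 1ℤ)) x)
                 (cong₂ _+_ (⟦⟧-⊙ (+ 3) f x) (⟦const⟧ (- 1ℤ) p))

-- Proof rules for families: residue classes, transformations, exceptional subfamilies

record Good (F : Family d) : Set where
  field represented : ∀ p → Represented (Σpent₂ (F at p))

open Good

-- The parameter numbered j becomes m times a new parameter plus r.
refine : Fin d → ℕ → ℤ → Affine d → Affine d
refine j m r (c ∷ f) = c + r * lookup f j ∷ f [ j ]%= (_* + m)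

⟦⟧-updateAt : ∀ (f : Form n) j m {r q} p → lookup p j ≡ r + q * + m →
  ⟦ f ⟧ p ≡ r * lookup f j + ⟦ f [ j ]%= (_* + m) ⟧ (p [ j ]%= (λ _ → q))
⟦⟧-updateAt (a ∷ f) zero m {r} {q} (x ∷ p) refl = rearrange a r q (+ m) (⟦ f ⟧ p)
  where
  rearrange : ∀ a r q m u → a * (r + q * m) + u ≡ r * a + (a * m * q + u)
  rearrange = solve-∀
⟦⟧-updateAt (a ∷ f) (suc j) m {r} {q} (x ∷ p) eq
  rewrite ⟦⟧-updateAt f j m {r} {q} p eq =
  rearrange (a * x) (r * lookup f j) (⟦ f [ j ]%= (_* + m) ⟧ (p [ j ]%= (λ _ → q)))
  where
  rearrange : ∀ u v w → u + (v + w) ≡ v + (u + w)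
  rearrange = solve-∀

⟦⟧-refine : ∀ (f : Affine d) j m {r q} p → lookup p j ≡ r + q * + m →
  ⟦ f ⟧ (1ℤ ∷ p) ≡ ⟦ refine j m r f ⟧ (1ℤ ∷ (p [ j ]%= (λ _ → q)))
⟦⟧-refine (c ∷ f) j m {r} {q} p eq rewrite ⟦⟧-updateAt f j m {r} {q} p eq =
  rearrange c (r * lookup f j) (⟦ f [ j ]%= (_* + m) ⟧ (p [ j ]%= (λ _ → q)))
  where
  rearrange : ∀ c u v → c * 1ℤ + (u + v) ≡ (c + u) * 1ℤ + v
  rearrange = solve-∀

-- A nested tuple closed by the unit value, so that the branches of a `split` are listed in the
-- order of the residues 0, ..., m - 1.
Cases : (n : ℕ) → (Fin n → Set) → Set
Cases zero P = ⊤
Cases (suc n) P = P zero × Cases n (λ i → P (suc i))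

case : ∀ n {P : Fin n → Set} → Cases n P → ∀ i → P i
case (suc n) (c , cs) zero = c
case (suc n) (c , cs) (suc i) = case n cs i

-- Restricting a parameter to a residue class makes its coefficients divisible by `m`, which can
-- make a rational transformation integral.
split : {F : Family d} (j : Fin d) (m : ℕ) .{{_ : ℕ.NonZero m}} →
        Cases m (λ r → Good (map (refine j m (+ toℕ r)) F)) → Good F
split {F = F} j m cs .represented p = subst Represented (sym (cong Σpent₂ at-eq)) (represented child p′)
  where
  x = lookup p j
  r = fromℕ< (n%ℕd<d x m)
  p′ = p [ j ]%= (λ _ → x /ℕ m)
  child : Good (map (refine j m (+ toℕ r)) F)
  child = case m cs r
  x-eq : x ≡ + toℕ r + x /ℕ m * + m
  x-eq = trans (a≡a%ℕn+[a/ℕn]*n x m) (cong (λ s → + s + x /ℕ m * + m) (sym (Fin.toℕ-fromℕ< _)))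
  at-eq : F at p ≡ map (refine j m (+ toℕ r)) F at p′
  at-eq = trans (Vec.map-cong (λ f → ⟦⟧-refine f j m {+ toℕ r} {x /ℕ m} p x-eq) F) (Vec.map-∘ _ _ F)

-- Here `f` is an index of the transformed family. Where it vanishes the transformation fails, and
-- the value of the original `F` has to be represented in another way.
record Exit (F : Family d) (f : Affine d) : Set where
  field leave : ∀ p → ⟦ f ⟧ (1ℤ ∷ p) ≡ 0ℤ → Represented (Σpent₂ (F at p))

open Exit

data Exits (F : Family d) : Vec (Affine d) n → Set where
  []  : Exits F []
  _∷_ : ∀ {f} {fs : Vec (Affine d) n} → Exit F f → Exits F fs → Exits F (f ∷ fs)

private
  nonzero-or-represented : ∀ {F : Family d} {fs : Vec (Affine d) n} → Exits F fs → ∀ p →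
    (All (λ t → ¬ t ≡ 0ℤ) (fs at p) → Represented (Σpent₂ (F at p))) → Represented (Σpent₂ (F at p))
  nonzero-or-represented [] p rep = rep []
  nonzero-or-represented {fs = f ∷ _} (x ∷ xs) p rep with ⟦ f ⟧ (1ℤ ∷ p) ℤ.≟ 0ℤ
  ... | yes f≡0 = leave x p f≡0
  ... | no  f≢0 = nonzero-or-represented xs p (λ all → rep (f≢0 ∷ all))

-- Equality of the two forms is all that is used of the orthogonal transformation. At each parameter
-- either all indices of `F′` are nonzero and represent the common value, or one vanishes and its
-- exit applies.
move : {F : Family d} (F′ : Family d) {_ : True (norm F ≟ norm F′)} → Exits F F′ → Good F
move {F = F} F′ {eq} xs .represented p = nonzero-or-represented xs p λ all _ → F′ at p , all , sums
  where
  sums : Σpent₂ (F at p) ≡ Σpent₂ (F′ at p)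
  sums = trans (sym (⟪norm⟫ F p)) (trans (cong (λ q → ⟪ q ⟫ (1ℤ ∷ p)) (toWitness eq)) (⟪norm⟫ F′ p))

∣⟦⟧ : ∀ {g} {f : Form n} → All (g Signed.∣_) f → ∀ xs → g Signed.∣ ⟦ f ⟧ xs
∣⟦⟧ [] [] = Signed.divides 0ℤ refl
∣⟦⟧ (g∣a ∷ g∣f) (x ∷ xs) = Signed.∣m∣n⇒∣m+n (Signed.∣m⇒∣m*n x g∣a) (∣⟦⟧ g∣f xs)

-- With g = 0 this covers nonzero constant forms.
never : {F : Family d} (g : ℤ) {c : ℤ} {f : Form d} →
        {_ : True (all? (g Signed.∣?_) f)} {_ : True (¬? (g Signed.∣? c))} → Exit F (c ∷ f)
never g {c} {f} {g∣f} {g∤c} .leave p f≡0 = ⊥-elim (toWitness g∤c g∣c)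
  where
  g∣c : g Signed.∣ c
  g∣c = subst (g Signed.∣_) (ℤ.*-identityʳ c) (Signed.∣m+n∣n⇒∣m
    (subst (g Signed.∣_) (sym f≡0) (Signed.divides 0ℤ refl)) (∣⟦⟧ (toWitness g∣f) p))

substitute : Vec (Affine e) d → Family d → Family e
substitute hs = map (_◃ (const 1ℤ ∷ hs))

substitute-at : (hs : Vec (Affine e) d) (G : Vec (Affine d) n) (p : Vec ℤ e) →
  map (_◃ (const 1ℤ ∷ hs)) G at p ≡ G at (hs at p)
substitute-at hs [] p = refl
substitute-at hs (g ∷ G) p = cong₂ _∷_
  (trans (⟦⟧-◃ g (const 1ℤ ∷ hs) (1ℤ ∷ p)) (cong (λ c → ⟦ g ⟧ (c ∷ hs at p)) (⟦const⟧ 1ℤ p)))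
  (substitute-at hs G p)

⟪norm-substitute⟫ : (hs : Vec (Affine e) d) (G : Family d) (p : Vec ℤ e) →
  ⟪ norm (substitute hs G) ⟫ (1ℤ ∷ p) ≡ Σpent₂ (G at (hs at p))
⟪norm-substitute⟫ hs G p = trans (⟪norm⟫ (substitute hs G) p) (cong Σpent₂ (substitute-at hs G p))

-- A change of parameters: the values of `F` are among those of `G`, so goodness is inherited.
reduce : {G : Family e} {F : Family d} → Good G → (hs : Vec (Affine d) e) →
         {_ : True (norm F ≟ norm (substitute hs G))} → Good F
reduce {G = G} {F} gG hs {eq} .represented p =
  subst Represented (sym sums) (represented gG (hs at p))
  where
  sums : Σpent₂ (F at p) ≡ Σpent₂ (G at (hs at p))
  sums = begin
    Σpent₂ (F at p)                      ≡⟨ ⟪norm⟫ F p ⟨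
    ⟪ norm F ⟫ (1ℤ ∷ p)                  ≡⟨ cong (λ q → ⟪ q ⟫ (1ℤ ∷ p)) (toWitness eq) ⟩
    ⟪ norm (substitute hs G) ⟫ (1ℤ ∷ p)  ≡⟨ ⟪norm-substitute⟫ hs G p ⟩
    Σpent₂ (G at (hs at p))              ∎

-- F and the substituted G take the same values where f = 0, since k times their difference is f ⊗ g.
via : {G : Family e} {F : Family d} {f : Affine d} → Good G → (hs : Vec (Affine d) e) →
      (k : ℕ) .{{_ : ℕ.NonZero k}} (g : Affine d) →
      {_ : True (+ k ⊡ norm F ≟ + k ⊡ norm (substitute hs G) ⊞ f ⊗ g)} → Exit F f
via {G = G} {F} {f} gG hs k@(suc _) g {eq} .leave p f≡0 =
  subst Represented (sym sums) (represented gG (hs at p))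
  where
  x = 1ℤ ∷ p
  Q = norm (substitute hs G)
  sums : Σpent₂ (F at p) ≡ Σpent₂ (G at (hs at p))
  sums = ℤ.*-cancelˡ-≡ (+ k) _ _ (begin
    + k * Σpent₂ (F at p)             ≡⟨ cong (+ k *_) (⟪norm⟫ F p) ⟨
    + k * ⟪ norm F ⟫ x                ≡⟨ ⟪⟫-⊡ (+ k) (norm F) x ⟨
    ⟪ + k ⊡ norm F ⟫ x                ≡⟨ cong (λ q → ⟪ q ⟫ x) (toWitness eq) ⟩
    ⟪ + k ⊡ Q ⊞ f ⊗ g ⟫ x             ≡⟨ ⟪⟫-⊞ (+ k ⊡ Q) (f ⊗ g) x ⟩
    ⟪ + k ⊡ Q ⟫ x + ⟪ f ⊗ g ⟫ x       ≡⟨ cong₂ _+_ (⟪⟫-⊡ (+ k) Q x) (⟪⟫-⊗ f g x) ⟩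
    + k * ⟪ Q ⟫ x + ⟦ f ⟧ x * ⟦ g ⟧ x ≡⟨ cong (λ z → + k * ⟪ Q ⟫ x + z * ⟦ g ⟧ x) f≡0 ⟩
    + k * ⟪ Q ⟫ x + 0ℤ                ≡⟨ ℤ.+-identityʳ _ ⟩
    + k * ⟪ Q ⟫ x                     ≡⟨ cong (+ k *_) (⟪norm-substitute⟫ hs G p) ⟩
    + k * Σpent₂ (G at (hs at p))     ∎)

-- Vacuous, since `Represented` concerns only doubled values from 8 on.
small : {F : Family 0} → {_ : True (Σpent₂ (F at []) ℤ.<? + 8)} → Good F
small {F} {lt} .represented [] 8≤N = ⊥-elim (ℤ.<⇒≱ (toWitness lt) 8≤N)

nonzero : {F : Family 0} → {_ : True (all? (λ t → ¬? (t ℤ.≟ 0ℤ)) (F at []))} → Good F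
nonzero {F} {nz} .represented [] _ = F at [] , toWitness nz , refl

-- Reduction of the number of zeros

-- The transformations were found by a computer search among the matrices of x ↦ β x γ / q on the quaternions,
-- where β and γ are Hurwitz quaternions of norm q ≤ 9.
module Reduction where

  open import Agda.Builtin.FromNat using (Number; fromNat)
  open import Agda.Builtin.FromNeg using (Negative; fromNeg)
  import Data.Integer.Literals as ℤ-Literals
  import Data.Nat.Literals as ℕ-Literals

  instance
    numberℕ : Number ℕ
    numberℕ = ℕ-Literals.number
    numberℤ : Number ℤ
    numberℤ = ℤ-Literals.number
    negativeℤ : Negative ℤ
    negativeℤ = ℤ-Literals.negative

  -- Families without parameters; the name shows the number represented

  number0 : Good ((0 ∷ []) ∷ (0 ∷ []) ∷ (0 ∷ []) ∷ (0 ∷ []) ∷ [])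
  number0 = small

  number1 : Good ((1 ∷ []) ∷ (0 ∷ []) ∷ (0 ∷ []) ∷ (0 ∷ []) ∷ [])
  number1 = small

  number2 : Good ((-1 ∷ []) ∷ (0 ∷ []) ∷ (0 ∷ []) ∷ (0 ∷ []) ∷ [])
  number2 = small

  number3 : Good ((1 ∷ []) ∷ (-1 ∷ []) ∷ (0 ∷ []) ∷ (0 ∷ []) ∷ [])
  number3 = small

  number4 : Good ((1 ∷ []) ∷ (1 ∷ []) ∷ (1 ∷ []) ∷ (1 ∷ []) ∷ [])
  number4 = nonzero

  number6 : Good ((1 ∷ []) ∷ (1 ∷ []) ∷ (-1 ∷ []) ∷ (-1 ∷ []) ∷ [])
  number6 = nonzero

  number7 : Good ((1 ∷ []) ∷ (-1 ∷ []) ∷ (-1 ∷ []) ∷ (-1 ∷ []) ∷ [])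
  number7 = nonzero

  number9 : Good ((1 ∷ []) ∷ (1 ∷ []) ∷ (-1 ∷ []) ∷ (2 ∷ []) ∷ [])
  number9 = nonzero

  number15 : Good ((1 ∷ []) ∷ (1 ∷ []) ∷ (1 ∷ []) ∷ (3 ∷ []) ∷ [])
  number15 = nonzero

  number18 : Good ((1 ∷ []) ∷ (1 ∷ []) ∷ (1 ∷ []) ∷ (-3 ∷ []) ∷ [])
  number18 = nonzero

  number24 : Good ((1 ∷ []) ∷ (1 ∷ []) ∷ (-2 ∷ []) ∷ (-3 ∷ []) ∷ [])
  number24 = nonzero

  number28 : Good ((1 ∷ []) ∷ (2 ∷ []) ∷ (-2 ∷ []) ∷ (-3 ∷ []) ∷ [])
  number28 = nonzero

  -- Families with one or two parameters and at least one zero index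

  line1 : Good ((0 ∷ 0 ∷ []) ∷ (0 ∷ 0 ∷ []) ∷ (0 ∷ 0 ∷ []) ∷ (0 ∷ 1 ∷ []) ∷ [])
  line1 =
    split zero 2
      ( move ((0 ∷ 1 ∷ []) ∷ (0 ∷ 1 ∷ []) ∷ (0 ∷ 1 ∷ []) ∷ (0 ∷ -1 ∷ []) ∷ [])
          ( via number0 [] 1 (-2 ∷ 12 ∷ [])
          ∷ via number0 [] 1 (-2 ∷ 12 ∷ [])
          ∷ via number0 [] 1 (-2 ∷ 12 ∷ [])
          ∷ via number0 [] 1 (2 ∷ -12 ∷ [])
          ∷ [])
      -- For an odd index the four-coordinate reflection would give even entries. The column (2, 1,
      -- 4, 2) / 5 of norm 1 is used instead, up to signs and order, after a further split modulo 5.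
      , split zero 5
          ( move ((0 ∷ -4 ∷ []) ∷ (0 ∷ -2 ∷ []) ∷ (1 ∷ 8 ∷ []) ∷ (0 ∷ -4 ∷ []) ∷ [])
              -- The index is `10 q + 1`, and its `pent₂` exceeds that of 1 by `300 q² + 50 q`.
              -- Dividing by the new index `-4 q` leaves a fraction, which the factor 2 clears; the
              -- same rule gives the last two arguments of every `via`.
              ( via number1 [] 2 (-25 ∷ -150 ∷ [])
              ∷ via number1 [] 1 (-25 ∷ -150 ∷ [])
              ∷ never 8
              ∷ via number1 [] 2 (-25 ∷ -150 ∷ [])
              ∷ [])
          , move ((-1 ∷ -4 ∷ []) ∷ (-2 ∷ -8 ∷ []) ∷ (1 ∷ 2 ∷ []) ∷ (-1 ∷ -4 ∷ []) ∷ [])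
              (never 4 ∷ never 8 ∷ never 2 ∷ never 4 ∷ [])
          , move ((4 ∷ 8 ∷ []) ∷ (2 ∷ 4 ∷ []) ∷ (-2 ∷ -4 ∷ []) ∷ (1 ∷ 2 ∷ []) ∷ [])
              (never 8 ∷ never 4 ∷ never 4 ∷ never 2 ∷ [])
          , move ((-6 ∷ -9 ∷ []) ∷ (-2 ∷ -3 ∷ []) ∷ (2 ∷ 3 ∷ []) ∷ (1 ∷ 1 ∷ []) ∷ [])
              -- The index is `10 q + 7`. At `q = -1` it is -3, whose pentagonal number is 15.
              (never 9 ∷ never 3 ∷ never 3 ∷ via number15 [] 1 (110 ∷ 300 ∷ []) ∷ [])
          , move ((3 ∷ 3 ∷ []) ∷ (1 ∷ 1 ∷ []) ∷ (8 ∷ 9 ∷ []) ∷ (3 ∷ 3 ∷ []) ∷ [])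
              ( via number2 [] 3 (230 ∷ 300 ∷ [])
              ∷ via number2 [] 1 (230 ∷ 300 ∷ [])
              ∷ never 9
              ∷ via number2 [] 3 (230 ∷ 300 ∷ [])
              ∷ [])
          , _)
      , _)

  line2 : Good ((0 ∷ 0 ∷ []) ∷ (0 ∷ 0 ∷ []) ∷ (1 ∷ 0 ∷ []) ∷ (0 ∷ 1 ∷ []) ∷ [])
  line2 =
    split zero 2
      ( move ((0 ∷ -1 ∷ []) ∷ (1 ∷ -1 ∷ []) ∷ (0 ∷ -1 ∷ []) ∷ (0 ∷ -1 ∷ []) ∷ [])
          ( via number1 [] 1 (2 ∷ -12 ∷ [])
          ∷ via number6 [] 1 (-10 ∷ -12 ∷ [])
          ∷ via number1 [] 1 (2 ∷ -12 ∷ [])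
          ∷ via number1 [] 1 (2 ∷ -12 ∷ [])
          ∷ [])
      , move ((1 ∷ 1 ∷ []) ∷ (1 ∷ 1 ∷ []) ∷ (0 ∷ 1 ∷ []) ∷ (0 ∷ -1 ∷ []) ∷ [])
          ( via number3 [] 1 (-2 ∷ 12 ∷ [])
          ∷ via number3 [] 1 (-2 ∷ 12 ∷ [])
          ∷ via number2 [] 1 (10 ∷ 12 ∷ [])
          ∷ via number2 [] 1 (-10 ∷ -12 ∷ [])
          ∷ [])
      , _)

  line3 : Good ((-1 ∷ 0 ∷ []) ∷ (0 ∷ 0 ∷ []) ∷ (0 ∷ 0 ∷ []) ∷ (0 ∷ 1 ∷ []) ∷ [])
  line3 =
    split zero 2
      ( move ((0 ∷ 1 ∷ []) ∷ (0 ∷ 1 ∷ []) ∷ (1 ∷ -1 ∷ []) ∷ (1 ∷ 1 ∷ []) ∷ [])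
          ( via number2 [] 1 (-2 ∷ 12 ∷ [])
          ∷ via number2 [] 1 (-2 ∷ 12 ∷ [])
          ∷ via number7 [] 1 (-10 ∷ -12 ∷ [])
          ∷ via number9 [] 1 (-14 ∷ 12 ∷ [])
          ∷ [])
      , move ((1 ∷ 1 ∷ []) ∷ (0 ∷ 1 ∷ []) ∷ (0 ∷ 1 ∷ []) ∷ (-1 ∷ -1 ∷ []) ∷ [])
          ( via number4 [] 1 (-2 ∷ 12 ∷ [])
          ∷ via number3 [] 1 (10 ∷ 12 ∷ [])
          ∷ via number3 [] 1 (10 ∷ 12 ∷ [])
          ∷ via number4 [] 1 (2 ∷ -12 ∷ [])
          ∷ [])
      , _)

  -- The reflection acts on the two zeros and the third index, unless that index is 1 modulo 3. In
  -- that class the columns (8, 4, 1) / 9 and (4, 7, 4) / 9 of norm 1, up to signs, serve on the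
  -- three classes modulo 9.
  plane1 : Good ((0 ∷ 0 ∷ 0 ∷ []) ∷ (0 ∷ 0 ∷ 0 ∷ []) ∷ (0 ∷ 1 ∷ 0 ∷ []) ∷ (0 ∷ 0 ∷ 1 ∷ []) ∷ [])
  plane1 =
    split zero 3
      ( move ((0 ∷ 0 ∷ 1 ∷ []) ∷ (0 ∷ 2 ∷ 0 ∷ []) ∷ (0 ∷ 2 ∷ 0 ∷ []) ∷ (0 ∷ -1 ∷ 0 ∷ []) ∷ [])
          ( via line1 ((0 ∷ 3 ∷ 0 ∷ []) ∷ []) 1 (-1 ∷ 0 ∷ 3 ∷ [])
          ∷ via line1 ((0 ∷ 0 ∷ 1 ∷ []) ∷ []) 2 (-3 ∷ 27 ∷ 0 ∷ [])
          ∷ via line1 ((0 ∷ 0 ∷ 1 ∷ []) ∷ []) 2 (-3 ∷ 27 ∷ 0 ∷ [])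
          ∷ via line1 ((0 ∷ 0 ∷ 1 ∷ []) ∷ []) 1 (3 ∷ -27 ∷ 0 ∷ [])
          ∷ [])
      , split zero 3
          ( move ((0 ∷ 0 ∷ 1 ∷ []) ∷ (1 ∷ 8 ∷ 0 ∷ []) ∷ (0 ∷ -4 ∷ 0 ∷ []) ∷ (0 ∷ -1 ∷ 0 ∷ []) ∷ [])
              ( via line1 ((1 ∷ 9 ∷ 0 ∷ []) ∷ []) 1 (-1 ∷ 0 ∷ 3 ∷ [])
              ∷ never 8
              ∷ via line2 ((0 ∷ 0 ∷ 1 ∷ []) ∷ []) 4 (-45 ∷ -243 ∷ 0 ∷ [])
              ∷ via line2 ((0 ∷ 0 ∷ 1 ∷ []) ∷ []) 1 (-45 ∷ -243 ∷ 0 ∷ [])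
              ∷ [])
          , move ((0 ∷ 0 ∷ 1 ∷ []) ∷ (2 ∷ 4 ∷ 0 ∷ []) ∷ (3 ∷ 7 ∷ 0 ∷ []) ∷ (2 ∷ 4 ∷ 0 ∷ []) ∷ [])
              (via line1 ((4 ∷ 9 ∷ 0 ∷ []) ∷ []) 1 (-1 ∷ 0 ∷ 3 ∷ []) ∷ never 4 ∷ never 7 ∷ never 4 ∷ [])
          , move ((0 ∷ 0 ∷ 1 ∷ []) ∷ (-3 ∷ -4 ∷ 0 ∷ []) ∷ (-5 ∷ -7 ∷ 0 ∷ []) ∷ (-3 ∷ -4 ∷ 0 ∷ []) ∷ [])
              (via line1 ((7 ∷ 9 ∷ 0 ∷ []) ∷ []) 1 (-1 ∷ 0 ∷ 3 ∷ []) ∷ never 4 ∷ never 7 ∷ never 4 ∷ [])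
          , _)
      , move ((0 ∷ 0 ∷ 1 ∷ []) ∷ (-1 ∷ -2 ∷ 0 ∷ []) ∷ (-1 ∷ -2 ∷ 0 ∷ []) ∷ (1 ∷ 1 ∷ 0 ∷ []) ∷ [])
          ( via line1 ((2 ∷ 3 ∷ 0 ∷ []) ∷ []) 1 (-1 ∷ 0 ∷ 3 ∷ [])
          ∷ never 2
          ∷ never 2
          ∷ via line3 ((0 ∷ 0 ∷ 1 ∷ []) ∷ []) 1 (6 ∷ 27 ∷ 0 ∷ [])
          ∷ [])
      , _)

  line4 : Good ((0 ∷ 0 ∷ []) ∷ (0 ∷ 1 ∷ []) ∷ (0 ∷ -1 ∷ []) ∷ (0 ∷ -1 ∷ []) ∷ [])
  line4 =
    split zero 5
      ( move ((0 ∷ -8 ∷ []) ∷ (0 ∷ 1 ∷ []) ∷ (0 ∷ -1 ∷ []) ∷ (0 ∷ 3 ∷ []) ∷ [])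
          ( via number0 [] 8 (-5 ∷ -225 ∷ [])
          ∷ via number0 [] 1 (5 ∷ 225 ∷ [])
          ∷ via number0 [] 1 (-5 ∷ -225 ∷ [])
          ∷ via number0 [] 3 (5 ∷ 225 ∷ [])
          ∷ [])
      , move ((-1 ∷ -5 ∷ []) ∷ (1 ∷ 5 ∷ []) ∷ (1 ∷ 4 ∷ []) ∷ (1 ∷ 3 ∷ []) ∷ [])
          (never 5 ∷ never 5 ∷ never 4 ∷ never 3 ∷ [])
      , move ((-2 ∷ -5 ∷ []) ∷ (2 ∷ 5 ∷ []) ∷ (2 ∷ 4 ∷ []) ∷ (-1 ∷ -3 ∷ []) ∷ [])
          (never 5 ∷ never 5 ∷ never 4 ∷ never 3 ∷ [])
      , move ((-3 ∷ -5 ∷ []) ∷ (-3 ∷ -5 ∷ []) ∷ (-2 ∷ -4 ∷ []) ∷ (2 ∷ 3 ∷ []) ∷ [])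
          (never 5 ∷ never 5 ∷ never 4 ∷ never 3 ∷ [])
      , move ((-4 ∷ -5 ∷ []) ∷ (-4 ∷ -5 ∷ []) ∷ (-3 ∷ -4 ∷ []) ∷ (-2 ∷ -3 ∷ []) ∷ [])
          (never 5 ∷ never 5 ∷ never 4 ∷ never 3 ∷ [])
      , _)

  line5 : Good ((0 ∷ 0 ∷ []) ∷ (0 ∷ 1 ∷ []) ∷ (0 ∷ -2 ∷ []) ∷ (0 ∷ 2 ∷ []) ∷ [])
  line5 =
    split zero 5
      ( move ((0 ∷ 2 ∷ []) ∷ (0 ∷ 6 ∷ []) ∷ (0 ∷ -11 ∷ []) ∷ (0 ∷ 8 ∷ []) ∷ [])
          ( via number0 [] 2 (-5 ∷ 675 ∷ [])
          ∷ via number0 [] 6 (-5 ∷ 675 ∷ [])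
          ∷ via number0 [] 11 (5 ∷ -675 ∷ [])
          ∷ via number0 [] 8 (-5 ∷ 675 ∷ [])
          ∷ [])
      , move ((2 ∷ 10 ∷ []) ∷ (1 ∷ 5 ∷ []) ∷ (2 ∷ 8 ∷ []) ∷ (-1 ∷ -6 ∷ []) ∷ [])
          (never 10 ∷ never 5 ∷ never 8 ∷ never 6 ∷ [])
      , move ((-4 ∷ -10 ∷ []) ∷ (2 ∷ 5 ∷ []) ∷ (-3 ∷ -8 ∷ []) ∷ (-2 ∷ -6 ∷ []) ∷ [])
          (never 10 ∷ never 5 ∷ never 8 ∷ never 6 ∷ [])
      , move ((6 ∷ 10 ∷ []) ∷ (-6 ∷ -10 ∷ []) ∷ (-2 ∷ -4 ∷ []) ∷ (2 ∷ 3 ∷ []) ∷ [])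
          (never 10 ∷ never 10 ∷ never 4 ∷ never 3 ∷ [])
      , move ((8 ∷ 10 ∷ []) ∷ (-8 ∷ -10 ∷ []) ∷ (-3 ∷ -4 ∷ []) ∷ (-2 ∷ -3 ∷ []) ∷ [])
          (never 10 ∷ never 10 ∷ never 4 ∷ never 3 ∷ [])
      , _)

  line6 : Good ((0 ∷ 0 ∷ []) ∷ (0 ∷ 1 ∷ []) ∷ (0 ∷ -2 ∷ []) ∷ (0 ∷ -1 ∷ []) ∷ [])
  line6 =
    split zero 5
      ( move ((0 ∷ -12 ∷ []) ∷ (0 ∷ -1 ∷ []) ∷ (0 ∷ 1 ∷ []) ∷ (0 ∷ 2 ∷ []) ∷ [])
          ( via number0 [] 6 (-5 ∷ -225 ∷ [])
          ∷ via number0 [] 1 (-10 ∷ -450 ∷ [])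
          ∷ via number0 [] 1 (10 ∷ 450 ∷ [])
          ∷ via number0 [] 1 (5 ∷ 225 ∷ [])
          ∷ [])
      , move ((-1 ∷ -5 ∷ []) ∷ (1 ∷ 5 ∷ []) ∷ (2 ∷ 8 ∷ []) ∷ (-1 ∷ -6 ∷ []) ∷ [])
          (never 5 ∷ never 5 ∷ never 8 ∷ never 6 ∷ [])
      , move ((-4 ∷ -10 ∷ []) ∷ (2 ∷ 5 ∷ []) ∷ (2 ∷ 4 ∷ []) ∷ (-1 ∷ -3 ∷ []) ∷ [])
          (never 10 ∷ never 5 ∷ never 4 ∷ never 3 ∷ [])
      , move ((-3 ∷ -5 ∷ []) ∷ (-6 ∷ -10 ∷ []) ∷ (-2 ∷ -4 ∷ []) ∷ (2 ∷ 3 ∷ []) ∷ [])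
          (never 5 ∷ never 10 ∷ never 4 ∷ never 3 ∷ [])
      , move ((-4 ∷ -5 ∷ []) ∷ (-8 ∷ -10 ∷ []) ∷ (-3 ∷ -4 ∷ []) ∷ (-2 ∷ -3 ∷ []) ∷ [])
          (never 5 ∷ never 10 ∷ never 4 ∷ never 3 ∷ [])
      , _)

  line7 : Good ((0 ∷ 0 ∷ []) ∷ (0 ∷ 1 ∷ []) ∷ (1 ∷ -2 ∷ []) ∷ (-1 ∷ 2 ∷ []) ∷ [])
  line7 =
    split zero 2
      ( move ((0 ∷ 1 ∷ []) ∷ (0 ∷ -1 ∷ []) ∷ (-1 ∷ 5 ∷ []) ∷ (1 ∷ -3 ∷ []) ∷ [])
          (via number3 [] 1 (-50 ∷ 108 ∷ []) ∷ via number3 [] 1 (50 ∷ -108 ∷ []) ∷ never 5 ∷ never 3 ∷ [])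
      , move ((-1 ∷ -3 ∷ []) ∷ (-1 ∷ -5 ∷ []) ∷ (0 ∷ -1 ∷ []) ∷ (0 ∷ -1 ∷ []) ∷ [])
          (never 3 ∷ never 5 ∷ via number4 [] 1 (-58 ∷ -108 ∷ []) ∷ via number4 [] 1 (-58 ∷ -108 ∷ []) ∷ [])
      , _)

  line8 : Good ((0 ∷ 0 ∷ []) ∷ (0 ∷ 1 ∷ []) ∷ (-1 ∷ -2 ∷ []) ∷ (0 ∷ -1 ∷ []) ∷ [])
  line8 =
    split zero 3
      ( move ((0 ∷ -3 ∷ []) ∷ (1 ∷ 2 ∷ []) ∷ (1 ∷ 5 ∷ []) ∷ (0 ∷ -4 ∷ []) ∷ [])
          (via number2 [] 1 (-14 ∷ -54 ∷ []) ∷ never 2 ∷ never 5 ∷ via number2 [] 2 (-21 ∷ -81 ∷ []) ∷ [])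
      , move ((2 ∷ 5 ∷ []) ∷ (-2 ∷ -4 ∷ []) ∷ (2 ∷ 3 ∷ []) ∷ (1 ∷ 2 ∷ []) ∷ [])
          (never 5 ∷ never 4 ∷ never 3 ∷ never 2 ∷ [])
      , move ((-2 ∷ -3 ∷ []) ∷ (-2 ∷ -2 ∷ []) ∷ (-4 ∷ -5 ∷ []) ∷ (3 ∷ 4 ∷ []) ∷ [])
          (never 3 ∷ via number4 [] 1 (-48 ∷ -81 ∷ []) ∷ never 5 ∷ never 4 ∷ [])
      , _)

  line9 : Good ((0 ∷ 0 ∷ []) ∷ (0 ∷ 1 ∷ []) ∷ (1 ∷ -6 ∷ []) ∷ (0 ∷ -1 ∷ []) ∷ [])
  line9 =
    split zero 3
      ( move ((0 ∷ 7 ∷ []) ∷ (1 ∷ -14 ∷ []) ∷ (0 ∷ 9 ∷ []) ∷ (0 ∷ 4 ∷ []) ∷ [])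
          ( via number1 [] 7 (-90 ∷ 1026 ∷ [])
          ∷ never 14
          ∷ via number1 [] 1 (-10 ∷ 114 ∷ [])
          ∷ via number1 [] 2 (-45 ∷ 513 ∷ [])
          ∷ [])
      , move ((-1 ∷ -3 ∷ []) ∷ (3 ∷ 10 ∷ []) ∷ (4 ∷ 13 ∷ []) ∷ (-2 ∷ -8 ∷ []) ∷ [])
          (never 3 ∷ never 10 ∷ never 13 ∷ never 8 ∷ [])
      , move ((-2 ∷ -3 ∷ []) ∷ (-6 ∷ -10 ∷ []) ∷ (-8 ∷ -13 ∷ []) ∷ (5 ∷ 8 ∷ []) ∷ [])
          (never 3 ∷ never 10 ∷ never 13 ∷ never 8 ∷ [])
      , _)

  line10 : Good ((0 ∷ 0 ∷ []) ∷ (1 ∷ 0 ∷ []) ∷ (0 ∷ 1 ∷ []) ∷ (0 ∷ -1 ∷ []) ∷ [])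
  line10 =
    split zero 5
      ( move ((0 ∷ -6 ∷ []) ∷ (1 ∷ -2 ∷ []) ∷ (0 ∷ -3 ∷ []) ∷ (0 ∷ -1 ∷ []) ∷ [])
          ( via number1 [] 1 (0 ∷ -25 ∷ [])
          ∷ never 2
          ∷ via number1 [] 1 (0 ∷ -50 ∷ [])
          ∷ via number1 [] 1 (0 ∷ -150 ∷ [])
          ∷ [])
      , move ((1 ∷ 5 ∷ []) ∷ (1 ∷ 0 ∷ []) ∷ (1 ∷ 4 ∷ []) ∷ (1 ∷ 3 ∷ []) ∷ [])
          (never 5 ∷ never 0 ∷ never 4 ∷ never 3 ∷ [])
      , move ((2 ∷ 5 ∷ []) ∷ (1 ∷ 0 ∷ []) ∷ (2 ∷ 4 ∷ []) ∷ (-1 ∷ -3 ∷ []) ∷ [])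
          (never 5 ∷ never 0 ∷ never 4 ∷ never 3 ∷ [])
      , move ((-3 ∷ -5 ∷ []) ∷ (1 ∷ 0 ∷ []) ∷ (-2 ∷ -4 ∷ []) ∷ (2 ∷ 3 ∷ []) ∷ [])
          (never 5 ∷ never 0 ∷ never 4 ∷ never 3 ∷ [])
      , move ((-4 ∷ -5 ∷ []) ∷ (1 ∷ 0 ∷ []) ∷ (-3 ∷ -4 ∷ []) ∷ (-2 ∷ -3 ∷ []) ∷ [])
          (never 5 ∷ never 0 ∷ never 4 ∷ never 3 ∷ [])
      , _)

  line11 : Good ((0 ∷ 0 ∷ []) ∷ (0 ∷ 1 ∷ []) ∷ (-1 ∷ -6 ∷ []) ∷ (0 ∷ -1 ∷ []) ∷ [])
  line11 =
    split zero 3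
      ( move ((0 ∷ -3 ∷ []) ∷ (1 ∷ 10 ∷ []) ∷ (1 ∷ 13 ∷ []) ∷ (0 ∷ -8 ∷ []) ∷ [])
          (via number2 [] 1 (-42 ∷ -342 ∷ []) ∷ never 10 ∷ never 13 ∷ via number2 [] 4 (-63 ∷ -513 ∷ []) ∷ [])
      , move ((-1 ∷ -3 ∷ []) ∷ (-4 ∷ -10 ∷ []) ∷ (-5 ∷ -13 ∷ []) ∷ (3 ∷ 8 ∷ []) ∷ [])
          (never 3 ∷ never 10 ∷ never 13 ∷ never 8 ∷ [])
      , move ((2 ∷ 3 ∷ []) ∷ (-10 ∷ -14 ∷ []) ∷ (3 ∷ 4 ∷ []) ∷ (-8 ∷ -11 ∷ []) ∷ [])
          (never 3 ∷ never 14 ∷ never 4 ∷ never 11 ∷ [])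
      , _)

  -- Write the indices as 0, a, -a, b. If 3 divides b, the reflection applies to b, the zero and one
  -- of a, -a. Otherwise denominator 2 serves for even b and denominator 6 for odd b.
  plane2 : Good ((0 ∷ 0 ∷ 0 ∷ []) ∷ (0 ∷ 1 ∷ 0 ∷ []) ∷ (0 ∷ -1 ∷ 0 ∷ []) ∷ (0 ∷ 0 ∷ 1 ∷ []) ∷ [])
  plane2 =
    split (suc zero) 3
      ( split zero 3
          ( move ((0 ∷ -3 ∷ 0 ∷ []) ∷ (0 ∷ 2 ∷ 2 ∷ []) ∷ (0 ∷ -1 ∷ 2 ∷ []) ∷ (0 ∷ 2 ∷ -1 ∷ []) ∷ [])
              ( via line1 ((0 ∷ 0 ∷ 3 ∷ []) ∷ []) 1 (0 ∷ -18 ∷ 0 ∷ [])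
              ∷ via line4 ((0 ∷ 3 ∷ 0 ∷ []) ∷ []) 2 (-3 ∷ -27 ∷ 27 ∷ [])
              ∷ via line5 ((0 ∷ 0 ∷ 3 ∷ []) ∷ []) 1 (0 ∷ -54 ∷ -108 ∷ [])
              ∷ via line6 ((0 ∷ -3 ∷ 0 ∷ []) ∷ []) 1 (3 ∷ -54 ∷ -27 ∷ [])
              ∷ [])
          , move ((1 ∷ 3 ∷ 0 ∷ []) ∷ (1 ∷ 2 ∷ -2 ∷ []) ∷ (0 ∷ -1 ∷ -2 ∷ []) ∷ (1 ∷ 2 ∷ 1 ∷ []) ∷ [])
              ( never 3
              ∷ never 2
              ∷ via line7 ((0 ∷ 0 ∷ 3 ∷ []) ∷ []) 1 (-36 ∷ -54 ∷ 108 ∷ [])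
              ∷ via line8 ((1 ∷ 3 ∷ 0 ∷ []) ∷ []) 1 (-30 ∷ -54 ∷ 27 ∷ [])
              ∷ [])
          , move ((-2 ∷ -3 ∷ 0 ∷ []) ∷ (-1 ∷ -2 ∷ -2 ∷ []) ∷ (1 ∷ 1 ∷ -2 ∷ []) ∷ (-1 ∷ -2 ∷ 1 ∷ []) ∷ [])
              ( never 3
              ∷ never 2
              ∷ via line7 ((0 ∷ 0 ∷ 3 ∷ []) ∷ []) 1 (18 ∷ 54 ∷ 108 ∷ [])
              ∷ via line8 ((-2 ∷ -3 ∷ 0 ∷ []) ∷ []) 1 (24 ∷ 54 ∷ 27 ∷ [])
              ∷ [])
          , _)
      , split (suc zero) 2
          ( move ((0 ∷ 1 ∷ -1 ∷ []) ∷ (0 ∷ -1 ∷ -1 ∷ []) ∷ (1 ∷ 0 ∷ 5 ∷ []) ∷ (0 ∷ 0 ∷ -3 ∷ []) ∷ [])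
              ( via line9 ((0 ∷ -1 ∷ 0 ∷ []) ∷ []) 1 (-30 ∷ -108 ∷ -108 ∷ [])
              ∷ via line9 ((0 ∷ 1 ∷ 0 ∷ []) ∷ []) 1 (-30 ∷ 108 ∷ -108 ∷ [])
              ∷ never 5
              ∷ via line10 ((0 ∷ 1 ∷ 0 ∷ []) ∷ []) 1 (-10 ∷ 0 ∷ -36 ∷ [])
              ∷ [])
          , move ((2 ∷ 0 ∷ 3 ∷ []) ∷ (2 ∷ -1 ∷ 3 ∷ []) ∷ (2 ∷ 1 ∷ 3 ∷ []) ∷ (-2 ∷ 0 ∷ -3 ∷ []) ∷ [])
              ( never 3
              ∷ via line6 ((-2 ∷ 0 ∷ -3 ∷ []) ∷ []) 1 (-12 ∷ -6 ∷ -18 ∷ [])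
              ∷ via line6 ((-2 ∷ 0 ∷ -3 ∷ []) ∷ []) 1 (-12 ∷ 6 ∷ -18 ∷ [])
              ∷ never 3
              ∷ [])
          , _)
      , split (suc zero) 2
          ( move ((1 ∷ 0 ∷ 3 ∷ []) ∷ (1 ∷ -1 ∷ 3 ∷ []) ∷ (1 ∷ 1 ∷ 3 ∷ []) ∷ (-1 ∷ 0 ∷ -3 ∷ []) ∷ [])
              ( never 3
              ∷ via line6 ((-1 ∷ 0 ∷ -3 ∷ []) ∷ []) 1 (-6 ∷ -6 ∷ -18 ∷ [])
              ∷ via line6 ((-1 ∷ 0 ∷ -3 ∷ []) ∷ []) 1 (-6 ∷ 6 ∷ -18 ∷ [])
              ∷ never 3
              ∷ [])
          , move ((1 ∷ -1 ∷ 1 ∷ []) ∷ (1 ∷ 1 ∷ 1 ∷ []) ∷ (-4 ∷ 0 ∷ -5 ∷ []) ∷ (-2 ∷ 0 ∷ -3 ∷ []) ∷ [])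
              ( via line11 ((0 ∷ -1 ∷ 0 ∷ []) ∷ []) 1 (66 ∷ 108 ∷ 108 ∷ [])
              ∷ via line11 ((0 ∷ 1 ∷ 0 ∷ []) ∷ []) 1 (66 ∷ -108 ∷ 108 ∷ [])
              ∷ never 5
              ∷ never 3
              ∷ [])
          , _)
      , _)

  line12 : Good ((0 ∷ 0 ∷ []) ∷ (0 ∷ 1 ∷ []) ∷ (0 ∷ 2 ∷ []) ∷ (0 ∷ 5 ∷ []) ∷ [])
  line12 =
    move ((0 ∷ 4 ∷ []) ∷ (0 ∷ 3 ∷ []) ∷ (0 ∷ 2 ∷ []) ∷ (0 ∷ -1 ∷ []) ∷ [])
      ( via number0 [] 2 (-4 ∷ 45 ∷ [])
      ∷ via number0 [] 3 (-8 ∷ 90 ∷ [])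
      ∷ via number0 [] 1 (-4 ∷ 45 ∷ [])
      ∷ via number0 [] 1 (8 ∷ -90 ∷ [])
      ∷ [])

  line13 : Good ((0 ∷ 0 ∷ []) ∷ (0 ∷ 4 ∷ []) ∷ (0 ∷ -5 ∷ []) ∷ (0 ∷ 8 ∷ []) ∷ [])
  line13 =
    move ((0 ∷ 4 ∷ []) ∷ (0 ∷ 2 ∷ []) ∷ (0 ∷ 7 ∷ []) ∷ (0 ∷ -6 ∷ []) ∷ [])
      ( via number0 [] 4 (-7 ∷ 315 ∷ [])
      ∷ via number0 [] 2 (-7 ∷ 315 ∷ [])
      ∷ via number0 [] 1 (-1 ∷ 45 ∷ [])
      ∷ via number0 [] 6 (7 ∷ -315 ∷ [])
      ∷ [])

  line14 : Good ((0 ∷ 0 ∷ []) ∷ (0 ∷ 0 ∷ []) ∷ (0 ∷ 1 ∷ []) ∷ (0 ∷ 2 ∷ []) ∷ [])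
  line14 =
    split zero 3
      ( move ((0 ∷ 6 ∷ []) ∷ (0 ∷ 2 ∷ []) ∷ (0 ∷ 2 ∷ []) ∷ (0 ∷ -1 ∷ []) ∷ [])
          ( via number0 [] 2 (-3 ∷ 45 ∷ [])
          ∷ via number0 [] 2 (-9 ∷ 135 ∷ [])
          ∷ via number0 [] 2 (-9 ∷ 135 ∷ [])
          ∷ via number0 [] 1 (9 ∷ -135 ∷ [])
          ∷ [])
      , move ((1 ∷ 3 ∷ []) ∷ (-1 ∷ -4 ∷ []) ∷ (-1 ∷ -4 ∷ []) ∷ (1 ∷ 2 ∷ []) ∷ [])
          (never 3 ∷ never 4 ∷ never 4 ∷ never 2 ∷ [])
      , move ((4 ∷ 6 ∷ []) ∷ (-1 ∷ -2 ∷ []) ∷ (-1 ∷ -2 ∷ []) ∷ (1 ∷ 1 ∷ []) ∷ [])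
          (never 6 ∷ never 2 ∷ never 2 ∷ via number9 [] 1 (36 ∷ 135 ∷ []) ∷ [])
      , _)

  line15 : Good ((0 ∷ 0 ∷ []) ∷ (0 ∷ 1 ∷ []) ∷ (1 ∷ -5 ∷ []) ∷ (0 ∷ 2 ∷ []) ∷ [])
  line15 =
    split zero 3
      ( move ((0 ∷ 2 ∷ []) ∷ (1 ∷ -16 ∷ []) ∷ (0 ∷ 3 ∷ []) ∷ (0 ∷ -1 ∷ []) ∷ [])
          ( via number1 [] 1 (-42 ∷ 405 ∷ [])
          ∷ never 16
          ∷ via number1 [] 1 (-28 ∷ 270 ∷ [])
          ∷ via number1 [] 1 (84 ∷ -810 ∷ [])
          ∷ [])
      , move ((2 ∷ 6 ∷ []) ∷ (-2 ∷ -8 ∷ []) ∷ (-3 ∷ -11 ∷ []) ∷ (2 ∷ 7 ∷ []) ∷ [])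
          (never 6 ∷ never 8 ∷ never 11 ∷ never 7 ∷ [])
      , move ((4 ∷ 6 ∷ []) ∷ (5 ∷ 8 ∷ []) ∷ (7 ∷ 11 ∷ []) ∷ (-4 ∷ -7 ∷ []) ∷ [])
          (never 6 ∷ never 8 ∷ never 11 ∷ never 7 ∷ [])
      , _)

  line16 : Good ((0 ∷ 0 ∷ []) ∷ (1 ∷ 4 ∷ []) ∷ (1 ∷ 5 ∷ []) ∷ (2 ∷ 8 ∷ []) ∷ [])
  line16 =
    move ((2 ∷ 8 ∷ []) ∷ (-1 ∷ -6 ∷ []) ∷ (0 ∷ -2 ∷ []) ∷ (0 ∷ -1 ∷ []) ∷ [])
      (never 8 ∷ never 6 ∷ via number7 [] 2 (-133 ∷ -315 ∷ []) ∷ via number7 [] 1 (-133 ∷ -315 ∷ []) ∷ [])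

  line17 : Good ((0 ∷ 0 ∷ []) ∷ (1 ∷ 0 ∷ []) ∷ (0 ∷ 1 ∷ []) ∷ (0 ∷ 2 ∷ []) ∷ [])
  line17 =
    split zero 2
      ( move ((1 ∷ -1 ∷ []) ∷ (0 ∷ 1 ∷ []) ∷ (0 ∷ 3 ∷ []) ∷ (0 ∷ -3 ∷ []) ∷ [])
          ( via number28 [] 1 (-54 ∷ -60 ∷ [])
          ∷ via number1 [] 1 (-6 ∷ 60 ∷ [])
          ∷ via number1 [] 1 (-2 ∷ 20 ∷ [])
          ∷ via number1 [] 1 (2 ∷ -20 ∷ [])
          ∷ [])
      , move ((2 ∷ 3 ∷ []) ∷ (-1 ∷ -3 ∷ []) ∷ (0 ∷ -1 ∷ []) ∷ (0 ∷ 1 ∷ []) ∷ [])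
          (never 3 ∷ never 3 ∷ via number7 [] 1 (-54 ∷ -60 ∷ []) ∷ via number7 [] 1 (54 ∷ 60 ∷ []) ∷ [])
      , _)

  line18 : Good ((0 ∷ 0 ∷ []) ∷ (0 ∷ 1 ∷ []) ∷ (0 ∷ -3 ∷ []) ∷ (0 ∷ 2 ∷ []) ∷ [])
  line18 =
    split zero 3
      ( move ((0 ∷ 6 ∷ []) ∷ (0 ∷ -4 ∷ []) ∷ (0 ∷ -7 ∷ []) ∷ (0 ∷ 5 ∷ []) ∷ [])
          ( via number0 [] 1 (0 ∷ 63 ∷ [])
          ∷ via number0 [] 2 (0 ∷ -189 ∷ [])
          ∷ via number0 [] 1 (0 ∷ -54 ∷ [])
          ∷ via number0 [] 5 (0 ∷ 378 ∷ [])
          ∷ [])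
      , move ((1 ∷ 3 ∷ []) ∷ (1 ∷ 2 ∷ []) ∷ (-2 ∷ -7 ∷ []) ∷ (3 ∷ 8 ∷ []) ∷ [])
          (never 3 ∷ never 2 ∷ never 7 ∷ never 8 ∷ [])
      , move ((4 ∷ 6 ∷ []) ∷ (3 ∷ 4 ∷ []) ∷ (5 ∷ 7 ∷ []) ∷ (-3 ∷ -5 ∷ []) ∷ [])
          (never 6 ∷ never 4 ∷ never 7 ∷ never 5 ∷ [])
      , _)

  line19 : Good ((0 ∷ 0 ∷ []) ∷ (0 ∷ 1 ∷ []) ∷ (0 ∷ 2 ∷ []) ∷ (0 ∷ 3 ∷ []) ∷ [])
  line19 =
    split zero 3
      ( move ((0 ∷ 6 ∷ []) ∷ (0 ∷ 8 ∷ []) ∷ (0 ∷ 5 ∷ []) ∷ (0 ∷ -1 ∷ []) ∷ [])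
          ( via number0 [] 1 (-3 ∷ 63 ∷ [])
          ∷ via number0 [] 4 (-9 ∷ 189 ∷ [])
          ∷ via number0 [] 5 (-18 ∷ 378 ∷ [])
          ∷ via number0 [] 1 (18 ∷ -378 ∷ [])
          ∷ [])
      , move ((1 ∷ 3 ∷ []) ∷ (-3 ∷ -10 ∷ []) ∷ (-1 ∷ -4 ∷ []) ∷ (0 ∷ -1 ∷ []) ∷ [])
          (never 3 ∷ never 10 ∷ never 4 ∷ via number18 [] 1 (-234 ∷ -378 ∷ []) ∷ [])
      , move ((4 ∷ 6 ∷ []) ∷ (-5 ∷ -8 ∷ []) ∷ (-3 ∷ -5 ∷ []) ∷ (1 ∷ 1 ∷ []) ∷ [])
          (never 6 ∷ never 8 ∷ never 5 ∷ via number24 [] 1 (108 ∷ 378 ∷ []) ∷ [])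
      , _)

  line20 : Good ((0 ∷ 0 ∷ []) ∷ (0 ∷ 1 ∷ []) ∷ (0 ∷ 1 ∷ []) ∷ (0 ∷ 2 ∷ []) ∷ [])
  line20 =
    split zero 5
      ( move ((0 ∷ 8 ∷ []) ∷ (0 ∷ 9 ∷ []) ∷ (0 ∷ 1 ∷ []) ∷ (0 ∷ 2 ∷ []) ∷ [])
          ( via number0 [] 4 (-10 ∷ 225 ∷ [])
          ∷ via number0 [] 9 (-20 ∷ 450 ∷ [])
          ∷ via number0 [] 1 (-20 ∷ 450 ∷ [])
          ∷ via number0 [] 1 (-10 ∷ 225 ∷ [])
          ∷ [])
      , move ((1 ∷ 4 ∷ []) ∷ (-1 ∷ -7 ∷ []) ∷ (-1 ∷ -7 ∷ []) ∷ (-1 ∷ -6 ∷ []) ∷ [])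
          (never 4 ∷ never 7 ∷ never 7 ∷ never 6 ∷ [])
      , move ((2 ∷ 5 ∷ []) ∷ (2 ∷ 5 ∷ []) ∷ (-3 ∷ -8 ∷ []) ∷ (-2 ∷ -6 ∷ []) ∷ [])
          (never 5 ∷ never 5 ∷ never 8 ∷ never 6 ∷ [])
      , move ((6 ∷ 10 ∷ []) ∷ (3 ∷ 5 ∷ []) ∷ (-2 ∷ -4 ∷ []) ∷ (2 ∷ 3 ∷ []) ∷ [])
          (never 10 ∷ never 5 ∷ never 4 ∷ never 3 ∷ [])
      , move ((8 ∷ 10 ∷ []) ∷ (4 ∷ 5 ∷ []) ∷ (-3 ∷ -4 ∷ []) ∷ (-2 ∷ -3 ∷ []) ∷ [])
          (never 10 ∷ never 5 ∷ never 4 ∷ never 3 ∷ [])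
      , _)

  line21 : Good ((0 ∷ 0 ∷ []) ∷ (0 ∷ 1 ∷ []) ∷ (0 ∷ 2 ∷ []) ∷ (-3 ∷ 15 ∷ []) ∷ [])
  line21 =
    move ((2 ∷ -8 ∷ []) ∷ (1 ∷ -3 ∷ []) ∷ (-2 ∷ 11 ∷ []) ∷ (-1 ∷ 6 ∷ []) ∷ [])
      (never 8 ∷ never 3 ∷ never 11 ∷ never 6 ∷ [])

  line22 : Good ((0 ∷ 0 ∷ []) ∷ (2 ∷ 5 ∷ []) ∷ (3 ∷ 9 ∷ []) ∷ (6 ∷ 18 ∷ []) ∷ [])
  line22 =
    move ((4 ∷ 12 ∷ []) ∷ (-3 ∷ -9 ∷ []) ∷ (-4 ∷ -13 ∷ []) ∷ (2 ∷ 6 ∷ []) ∷ [])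
      (never 12 ∷ never 9 ∷ never 13 ∷ never 6 ∷ [])

  line23 : Good ((0 ∷ 0 ∷ []) ∷ (2 ∷ 3 ∷ []) ∷ (-3 ∷ -5 ∷ []) ∷ (4 ∷ 6 ∷ []) ∷ [])
  line23 =
    split zero 3
      ( move ((4 ∷ 18 ∷ []) ∷ (1 ∷ 4 ∷ []) ∷ (3 ∷ 13 ∷ []) ∷ (-2 ∷ -11 ∷ []) ∷ [])
          (never 18 ∷ never 4 ∷ never 13 ∷ never 11 ∷ [])
      , move ((10 ∷ 18 ∷ []) ∷ (-2 ∷ -4 ∷ []) ∷ (-7 ∷ -13 ∷ []) ∷ (6 ∷ 11 ∷ []) ∷ [])
          (never 18 ∷ never 4 ∷ never 13 ∷ never 11 ∷ [])
      , move ((-6 ∷ -7 ∷ []) ∷ (15 ∷ 17 ∷ []) ∷ (-14 ∷ -16 ∷ []) ∷ (-5 ∷ -6 ∷ []) ∷ [])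
          (never 7 ∷ never 17 ∷ never 16 ∷ never 6 ∷ [])
      , _)

  -- Denominator 5 serves unless the first parameter is 2 modulo 5. In that class equal parity of
  -- the parameters makes the index sum even and permits denominator 2; opposite parity takes
  -- denominator 10.
  plane3 : Good ((0 ∷ 0 ∷ 0 ∷ []) ∷ (0 ∷ 1 ∷ 0 ∷ []) ∷ (0 ∷ 0 ∷ 1 ∷ []) ∷ (0 ∷ 0 ∷ 2 ∷ []) ∷ [])
  plane3 =
    split zero 5
      ( move ((0 ∷ -2 ∷ 2 ∷ []) ∷ (0 ∷ 4 ∷ 1 ∷ []) ∷ (0 ∷ 1 ∷ 0 ∷ []) ∷ (0 ∷ 2 ∷ 0 ∷ []) ∷ [])
          ( via line12 ((0 ∷ 1 ∷ 0 ∷ []) ∷ []) 2 (-3 ∷ 15 ∷ 15 ∷ [])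
          ∷ via line13 ((0 ∷ -1 ∷ 0 ∷ []) ∷ []) 1 (-3 ∷ -60 ∷ 15 ∷ [])
          ∷ via line14 ((0 ∷ 0 ∷ 1 ∷ []) ∷ []) 1 (-5 ∷ 75 ∷ 0 ∷ [])
          ∷ via line14 ((0 ∷ 0 ∷ 1 ∷ []) ∷ []) 2 (-5 ∷ 75 ∷ 0 ∷ [])
          ∷ [])
      , move ((0 ∷ -2 ∷ -2 ∷ []) ∷ (1 ∷ 4 ∷ -1 ∷ []) ∷ (0 ∷ -1 ∷ 0 ∷ []) ∷ (0 ∷ -2 ∷ 0 ∷ []) ∷ [])
          ( via line15 ((0 ∷ -1 ∷ 0 ∷ []) ∷ []) 2 (3 ∷ 15 ∷ -15 ∷ [])
          ∷ via line16 ((0 ∷ 1 ∷ 0 ∷ []) ∷ []) 1 (-12 ∷ -60 ∷ -15 ∷ [])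
          ∷ via line17 ((0 ∷ 0 ∷ 1 ∷ []) ∷ []) 1 (-25 ∷ -75 ∷ 0 ∷ [])
          ∷ via line17 ((0 ∷ 0 ∷ 1 ∷ []) ∷ []) 2 (-25 ∷ -75 ∷ 0 ∷ [])
          ∷ [])
      , split zero 2
          ( split (suc zero) 2
              ( move ((1 ∷ 5 ∷ 3 ∷ []) ∷ (-1 ∷ -5 ∷ 3 ∷ []) ∷ (1 ∷ 5 ∷ 1 ∷ []) ∷ (1 ∷ 5 ∷ -1 ∷ []) ∷ [])
                  ( via line18 ((-4 ∷ -20 ∷ -10 ∷ []) ∷ []) 1 (-662 ∷ -3300 ∷ -1380 ∷ [])
                  ∷ via line19 ((4 ∷ 20 ∷ -10 ∷ []) ∷ []) 1 (638 ∷ 3300 ∷ -1380 ∷ [])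
                  ∷ via line6 ((2 ∷ 10 ∷ 0 ∷ []) ∷ []) 1 (-66 ∷ -300 ∷ 60 ∷ [])
                  ∷ via line20 ((2 ∷ 10 ∷ 0 ∷ []) ∷ []) 1 (-54 ∷ -300 ∷ -60 ∷ [])
                  ∷ [])
              , move ((2 ∷ 3 ∷ 3 ∷ []) ∷ (-1 ∷ 1 ∷ -3 ∷ []) ∷ (-1 ∷ -9 ∷ 1 ∷ []) ∷ (-1 ∷ -3 ∷ -1 ∷ []) ∷ [])
                  ( never 3
                  ∷ via line21 ((1 ∷ 0 ∷ 2 ∷ []) ∷ []) 1 (410 ∷ 300 ∷ 900 ∷ [])
                  ∷ via line22 ((0 ∷ 2 ∷ 0 ∷ []) ∷ []) 1 (114 ∷ 540 ∷ 60 ∷ [])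
                  ∷ via line23 ((-1 ∷ -2 ∷ 0 ∷ []) ∷ []) 1 (6 ∷ 180 ∷ -60 ∷ [])
                  ∷ [])
              , _)
          , split (suc zero) 2
              ( move ((2 ∷ 3 ∷ 3 ∷ []) ∷ (1 ∷ 1 ∷ -3 ∷ []) ∷ (-6 ∷ -9 ∷ 1 ∷ []) ∷ (-2 ∷ -3 ∷ -1 ∷ []) ∷ [])
                  ( never 3
                  ∷ via line21 ((0 ∷ 0 ∷ 2 ∷ []) ∷ []) 1 (110 ∷ 300 ∷ 900 ∷ [])
                  ∷ via line22 ((1 ∷ 2 ∷ 0 ∷ []) ∷ []) 1 (354 ∷ 540 ∷ 60 ∷ [])
                  ∷ via line23 ((-2 ∷ -2 ∷ 0 ∷ []) ∷ []) 1 (126 ∷ 180 ∷ -60 ∷ [])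
                  ∷ [])
              , move ((5 ∷ 5 ∷ 3 ∷ []) ∷ (-2 ∷ -5 ∷ 3 ∷ []) ∷ (4 ∷ 5 ∷ 1 ∷ []) ∷ (3 ∷ 5 ∷ -1 ∷ []) ∷ [])
                  ( via line18 ((-19 ∷ -20 ∷ -10 ∷ []) ∷ []) 1 (-3002 ∷ -3300 ∷ -1380 ∷ [])
                  ∷ via line19 ((9 ∷ 20 ∷ -10 ∷ []) ∷ []) 1 (1598 ∷ 3300 ∷ -1380 ∷ [])
                  ∷ via line6 ((7 ∷ 10 ∷ 0 ∷ []) ∷ []) 1 (-186 ∷ -300 ∷ 60 ∷ [])
                  ∷ via line20 ((7 ∷ 10 ∷ 0 ∷ []) ∷ []) 1 (-234 ∷ -300 ∷ -60 ∷ [])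
                  ∷ [])
              , _)
          , _)
      , move ((0 ∷ 0 ∷ 2 ∷ []) ∷ (0 ∷ 0 ∷ 1 ∷ []) ∷ (-2 ∷ -4 ∷ 0 ∷ []) ∷ (2 ∷ 3 ∷ 0 ∷ []) ∷ [])
          ( via line1 ((3 ∷ 5 ∷ 0 ∷ []) ∷ []) 2 (-3 ∷ 0 ∷ 15 ∷ [])
          ∷ via line1 ((3 ∷ 5 ∷ 0 ∷ []) ∷ []) 1 (-3 ∷ 0 ∷ 15 ∷ [])
          ∷ never 4
          ∷ never 3
          ∷ [])
      , move ((0 ∷ 0 ∷ 2 ∷ []) ∷ (0 ∷ 0 ∷ 1 ∷ []) ∷ (-3 ∷ -4 ∷ 0 ∷ []) ∷ (-2 ∷ -3 ∷ 0 ∷ []) ∷ [])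
          ( via line1 ((4 ∷ 5 ∷ 0 ∷ []) ∷ []) 2 (-3 ∷ 0 ∷ 15 ∷ [])
          ∷ via line1 ((4 ∷ 5 ∷ 0 ∷ []) ∷ []) 1 (-3 ∷ 0 ∷ 15 ∷ [])
          ∷ never 4
          ∷ never 3
          ∷ [])
      , _)

  line24 : Good ((0 ∷ 0 ∷ []) ∷ (0 ∷ 1 ∷ []) ∷ (0 ∷ 1 ∷ []) ∷ (-1 ∷ 2 ∷ []) ∷ [])
  line24 =
    split zero 3
      ( move ((-1 ∷ 6 ∷ []) ∷ (0 ∷ 4 ∷ []) ∷ (0 ∷ 1 ∷ []) ∷ (0 ∷ 1 ∷ []) ∷ [])
          ( never 6
          ∷ via number2 [] 2 (-24 ∷ 81 ∷ [])
          ∷ via number2 [] 1 (-48 ∷ 162 ∷ [])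
          ∷ via number2 [] 1 (-48 ∷ 162 ∷ [])
          ∷ [])
      , move ((1 ∷ 6 ∷ []) ∷ (-1 ∷ -4 ∷ []) ∷ (0 ∷ -1 ∷ []) ∷ (0 ∷ -1 ∷ []) ∷ [])
          (never 6 ∷ never 4 ∷ via number3 [] 1 (-60 ∷ -162 ∷ []) ∷ via number3 [] 1 (-60 ∷ -162 ∷ []) ∷ [])
      , move ((3 ∷ 5 ∷ []) ∷ (1 ∷ 2 ∷ []) ∷ (-2 ∷ -4 ∷ []) ∷ (-1 ∷ -3 ∷ []) ∷ [])
          (never 5 ∷ never 2 ∷ never 4 ∷ never 3 ∷ [])
      , _)

  line25 : Good ((0 ∷ 0 ∷ []) ∷ (0 ∷ 1 ∷ []) ∷ (-1 ∷ 2 ∷ []) ∷ (-2 ∷ 3 ∷ []) ∷ [])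
  line25 =
    split zero 3
      ( move ((1 ∷ -2 ∷ []) ∷ (-1 ∷ 4 ∷ []) ∷ (2 ∷ -9 ∷ []) ∷ (1 ∷ -5 ∷ []) ∷ [])
          (never 2 ∷ never 4 ∷ never 9 ∷ never 5 ∷ [])
      , move ((1 ∷ 6 ∷ []) ∷ (-1 ∷ -8 ∷ []) ∷ (0 ∷ -5 ∷ []) ∷ (0 ∷ 1 ∷ []) ∷ [])
          (never 6 ∷ never 8 ∷ via number3 [] 5 (-90 ∷ -378 ∷ []) ∷ via number3 [] 1 (90 ∷ 378 ∷ []) ∷ [])
      , move ((1 ∷ 2 ∷ []) ∷ (2 ∷ 5 ∷ []) ∷ (-4 ∷ -9 ∷ []) ∷ (-2 ∷ -4 ∷ []) ∷ [])
          (never 2 ∷ never 5 ∷ never 9 ∷ never 4 ∷ [])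
      , _)

  line26 : Good ((0 ∷ 0 ∷ []) ∷ (0 ∷ 1 ∷ []) ∷ (2 ∷ -3 ∷ []) ∷ (-1 ∷ 2 ∷ []) ∷ [])
  line26 =
    split zero 3
      ( move ((-1 ∷ 6 ∷ []) ∷ (-1 ∷ 4 ∷ []) ∷ (-1 ∷ 7 ∷ []) ∷ (1 ∷ -5 ∷ []) ∷ [])
          (never 6 ∷ never 4 ∷ never 7 ∷ never 5 ∷ [])
      , move ((1 ∷ 6 ∷ []) ∷ (0 ∷ -4 ∷ []) ∷ (-1 ∷ -7 ∷ []) ∷ (1 ∷ 5 ∷ []) ∷ [])
          (never 6 ∷ via number4 [] 2 (-54 ∷ -189 ∷ []) ∷ never 7 ∷ never 5 ∷ [])
      , move ((2 ∷ 3 ∷ []) ∷ (1 ∷ 2 ∷ []) ∷ (-3 ∷ -7 ∷ []) ∷ (4 ∷ 8 ∷ []) ∷ [])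
          (never 3 ∷ never 2 ∷ never 7 ∷ never 8 ∷ [])
      , _)

  line27 : Good ((0 ∷ 0 ∷ []) ∷ (0 ∷ 1 ∷ []) ∷ (1 ∷ -3 ∷ []) ∷ (-1 ∷ 2 ∷ []) ∷ [])
  line27 =
    split zero 3
      ( move ((0 ∷ 3 ∷ []) ∷ (0 ∷ -2 ∷ []) ∷ (-1 ∷ 7 ∷ []) ∷ (1 ∷ -8 ∷ []) ∷ [])
          (via number3 [] 1 (-30 ∷ 126 ∷ []) ∷ via number3 [] 1 (45 ∷ -189 ∷ []) ∷ never 7 ∷ never 8 ∷ [])
      , move ((1 ∷ 6 ∷ []) ∷ (1 ∷ 4 ∷ []) ∷ (2 ∷ 7 ∷ []) ∷ (-1 ∷ -5 ∷ []) ∷ [])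
          (never 6 ∷ never 4 ∷ never 7 ∷ never 5 ∷ [])
      , move ((3 ∷ 6 ∷ []) ∷ (-2 ∷ -4 ∷ []) ∷ (-4 ∷ -7 ∷ []) ∷ (3 ∷ 5 ∷ []) ∷ [])
          (never 6 ∷ never 4 ∷ never 7 ∷ never 5 ∷ [])
      , _)

  line28 : Good ((0 ∷ 0 ∷ []) ∷ (0 ∷ 1 ∷ []) ∷ (-1 ∷ 2 ∷ []) ∷ (-1 ∷ 3 ∷ []) ∷ [])
  line28 =
    split zero 3
      ( move ((-1 ∷ 6 ∷ []) ∷ (1 ∷ -8 ∷ []) ∷ (1 ∷ -5 ∷ []) ∷ (0 ∷ 1 ∷ []) ∷ [])
          (never 6 ∷ never 8 ∷ never 5 ∷ via number4 [] 1 (-108 ∷ 378 ∷ []) ∷ [])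
      , move ((-1 ∷ -4 ∷ []) ∷ (-1 ∷ -7 ∷ []) ∷ (-1 ∷ -6 ∷ []) ∷ (1 ∷ 5 ∷ []) ∷ [])
          (never 4 ∷ never 7 ∷ never 6 ∷ never 5 ∷ [])
      , move ((4 ∷ 7 ∷ []) ∷ (-1 ∷ -2 ∷ []) ∷ (-4 ∷ -8 ∷ []) ∷ (-1 ∷ -3 ∷ []) ∷ [])
          (never 7 ∷ never 2 ∷ never 8 ∷ never 3 ∷ [])
      , _)

  line29 : Good ((0 ∷ 0 ∷ []) ∷ (0 ∷ 1 ∷ []) ∷ (1 ∷ -2 ∷ []) ∷ (1 ∷ -1 ∷ []) ∷ [])
  line29 =
    split zero 3
      ( move ((1 ∷ -6 ∷ []) ∷ (1 ∷ -4 ∷ []) ∷ (0 ∷ -1 ∷ []) ∷ (0 ∷ -1 ∷ []) ∷ [])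
          (never 6 ∷ never 4 ∷ via number2 [] 1 (48 ∷ -162 ∷ []) ∷ via number2 [] 1 (48 ∷ -162 ∷ []) ∷ [])
      , move ((0 ∷ -3 ∷ []) ∷ (0 ∷ -2 ∷ []) ∷ (-1 ∷ -5 ∷ []) ∷ (1 ∷ 4 ∷ []) ∷ [])
          (via number3 [] 1 (-20 ∷ -54 ∷ []) ∷ via number3 [] 1 (-30 ∷ -81 ∷ []) ∷ never 5 ∷ never 4 ∷ [])
      , move ((-1 ∷ -3 ∷ []) ∷ (1 ∷ 2 ∷ []) ∷ (3 ∷ 5 ∷ []) ∷ (-2 ∷ -4 ∷ []) ∷ [])
          (never 3 ∷ never 2 ∷ never 5 ∷ never 4 ∷ [])
      , _)

  line30 : Good ((0 ∷ 0 ∷ []) ∷ (0 ∷ 1 ∷ []) ∷ (-1 ∷ 1 ∷ []) ∷ (-1 ∷ 2 ∷ []) ∷ [])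
  line30 =
    split zero 3
      ( move ((0 ∷ 3 ∷ []) ∷ (1 ∷ -2 ∷ []) ∷ (1 ∷ -5 ∷ []) ∷ (-1 ∷ 4 ∷ []) ∷ [])
          (via number4 [] 1 (-22 ∷ 54 ∷ []) ∷ never 2 ∷ never 5 ∷ never 4 ∷ [])
      , move ((1 ∷ 3 ∷ []) ∷ (1 ∷ 4 ∷ []) ∷ (0 ∷ -5 ∷ []) ∷ (0 ∷ -2 ∷ []) ∷ [])
          (never 3 ∷ never 4 ∷ via number2 [] 5 (-42 ∷ -162 ∷ []) ∷ via number2 [] 1 (-21 ∷ -81 ∷ []) ∷ [])
      , move ((2 ∷ 3 ∷ []) ∷ (-2 ∷ -4 ∷ []) ∷ (2 ∷ 5 ∷ []) ∷ (1 ∷ 2 ∷ []) ∷ [])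
          (never 3 ∷ never 4 ∷ never 5 ∷ never 2 ∷ [])
      , _)

  -- Every pair of parities admits a transformation with denominator 2, with signs depending on the
  -- pair.
  plane4 : Good ((0 ∷ 0 ∷ 0 ∷ []) ∷ (0 ∷ 1 ∷ 0 ∷ []) ∷ (0 ∷ 0 ∷ 1 ∷ []) ∷ (-1 ∷ 0 ∷ 2 ∷ []) ∷ [])
  plane4 =
    split zero 2
      ( split (suc zero) 2
          ( move ((0 ∷ 1 ∷ -1 ∷ []) ∷ (1 ∷ 1 ∷ -3 ∷ []) ∷ (1 ∷ -1 ∷ -3 ∷ []) ∷ (0 ∷ 1 ∷ 1 ∷ []) ∷ [])
              ( via line24 ((0 ∷ 2 ∷ 0 ∷ []) ∷ []) 1 (30 ∷ -60 ∷ -60 ∷ [])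
              ∷ via line25 ((0 ∷ 0 ∷ 2 ∷ []) ∷ []) 1 (-14 ∷ 12 ∷ 36 ∷ [])
              ∷ via line26 ((0 ∷ 0 ∷ 2 ∷ []) ∷ []) 1 (-10 ∷ -12 ∷ 36 ∷ [])
              ∷ via line8 ((0 ∷ 2 ∷ 0 ∷ []) ∷ []) 1 (-30 ∷ -60 ∷ 60 ∷ [])
              ∷ [])
          , move ((1 ∷ 1 ∷ 3 ∷ []) ∷ (1 ∷ -1 ∷ 3 ∷ []) ∷ (0 ∷ 1 ∷ 1 ∷ []) ∷ (0 ∷ 1 ∷ -1 ∷ []) ∷ [])
              ( via line27 ((1 ∷ 0 ∷ 2 ∷ []) ∷ []) 1 (-14 ∷ 12 ∷ -36 ∷ [])
              ∷ via line28 ((1 ∷ 0 ∷ 2 ∷ []) ∷ []) 1 (-10 ∷ -12 ∷ -36 ∷ [])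
              ∷ via line29 ((0 ∷ 2 ∷ 0 ∷ []) ∷ []) 1 (30 ∷ -60 ∷ 60 ∷ [])
              ∷ via line30 ((1 ∷ 2 ∷ 0 ∷ []) ∷ []) 1 (-30 ∷ -60 ∷ -60 ∷ [])
              ∷ [])
          , _)
      , split (suc zero) 2
          ( move ((0 ∷ 1 ∷ 3 ∷ []) ∷ (-1 ∷ -1 ∷ 3 ∷ []) ∷ (0 ∷ 1 ∷ 1 ∷ []) ∷ (1 ∷ 1 ∷ -1 ∷ []) ∷ [])
              ( via line27 ((0 ∷ 0 ∷ 2 ∷ []) ∷ []) 1 (10 ∷ 12 ∷ -36 ∷ [])
              ∷ via line28 ((0 ∷ 0 ∷ 2 ∷ []) ∷ []) 1 (2 ∷ -12 ∷ -36 ∷ [])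
              ∷ via line29 ((1 ∷ 2 ∷ 0 ∷ []) ∷ []) 1 (-30 ∷ -60 ∷ 60 ∷ [])
              ∷ via line30 ((2 ∷ 2 ∷ 0 ∷ []) ∷ []) 1 (-30 ∷ -60 ∷ -60 ∷ [])
              ∷ [])
          , move ((0 ∷ 1 ∷ -1 ∷ []) ∷ (0 ∷ 1 ∷ -3 ∷ []) ∷ (-1 ∷ -1 ∷ -3 ∷ []) ∷ (1 ∷ 1 ∷ 1 ∷ []) ∷ [])
              ( via line24 ((1 ∷ 2 ∷ 0 ∷ []) ∷ []) 1 (-30 ∷ -60 ∷ -60 ∷ [])
              ∷ via line25 ((1 ∷ 0 ∷ 2 ∷ []) ∷ []) 1 (10 ∷ 12 ∷ 36 ∷ [])
              ∷ via line26 ((1 ∷ 0 ∷ 2 ∷ []) ∷ []) 1 (2 ∷ -12 ∷ 36 ∷ [])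
              ∷ via line8 ((1 ∷ 2 ∷ 0 ∷ []) ∷ []) 1 (-30 ∷ -60 ∷ 60 ∷ [])
              ∷ [])
          , _)
      , _)

  line31 : Good ((0 ∷ 0 ∷ []) ∷ (2 ∷ 3 ∷ []) ∷ (-7 ∷ -9 ∷ []) ∷ (5 ∷ 6 ∷ []) ∷ [])
  line31 =
    move ((-5 ∷ -7 ∷ []) ∷ (4 ∷ 5 ∷ []) ∷ (-5 ∷ -6 ∷ []) ∷ (-3 ∷ -4 ∷ []) ∷ [])
      (never 7 ∷ never 5 ∷ never 6 ∷ never 4 ∷ [])

  plane5 : Good ((0 ∷ 0 ∷ 0 ∷ []) ∷ (2 ∷ 3 ∷ 0 ∷ []) ∷ (2 ∷ 0 ∷ 3 ∷ []) ∷ (-4 ∷ -3 ∷ -3 ∷ []) ∷ [])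
  plane5 =
    move ((-3 ∷ -3 ∷ -2 ∷ []) ∷ (3 ∷ 3 ∷ 1 ∷ []) ∷ (-2 ∷ 0 ∷ -3 ∷ []) ∷ (-1 ∷ 0 ∷ -2 ∷ []) ∷ [])
      ( via line31 ((1 ∷ 2 ∷ 1 ∷ []) ∷ []) 1 (378 ∷ 486 ∷ 162 ∷ [])
      ∷ via line31 ((0 ∷ 1 ∷ 0 ∷ []) ∷ []) 1 (-54 ∷ -108 ∷ 54 ∷ [])
      ∷ never 3
      ∷ never 2
      ∷ [])

  line32 : Good ((0 ∷ 0 ∷ []) ∷ (2 ∷ 6 ∷ []) ∷ (5 ∷ 21 ∷ []) ∷ (8 ∷ 33 ∷ []) ∷ [])
  line32 =
    move ((-2 ∷ -11 ∷ []) ∷ (4 ∷ 16 ∷ []) ∷ (-7 ∷ -30 ∷ []) ∷ (-4 ∷ -17 ∷ []) ∷ [])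
      (never 11 ∷ never 16 ∷ never 30 ∷ never 17 ∷ [])

  plane6 : Good ((0 ∷ 0 ∷ 0 ∷ []) ∷ (2 ∷ 3 ∷ 0 ∷ []) ∷ (5 ∷ 6 ∷ 9 ∷ []) ∷ (2 ∷ 3 ∷ -3 ∷ []) ∷ [])
  plane6 =
    move ((-3 ∷ -4 ∷ -7 ∷ []) ∷ (4 ∷ 5 ∷ 5 ∷ []) ∷ (1 ∷ 2 ∷ -4 ∷ []) ∷ (-2 ∷ -3 ∷ 0 ∷ []) ∷ [])
      (via line32 ((-1 ∷ -1 ∷ -2 ∷ []) ∷ []) 1 (882 ∷ 1134 ∷ 2646 ∷ []) ∷ never 5 ∷ never 2 ∷ never 3 ∷ [])

  line33 : Good ((0 ∷ 0 ∷ []) ∷ (2 ∷ 3 ∷ []) ∷ (-13 ∷ -21 ∷ []) ∷ (8 ∷ 12 ∷ []) ∷ [])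
  line33 =
    move ((7 ∷ 11 ∷ []) ∷ (13 ∷ 20 ∷ []) ∷ (2 ∷ 3 ∷ []) ∷ (5 ∷ 8 ∷ []) ∷ [])
      (never 11 ∷ never 20 ∷ never 3 ∷ never 8 ∷ [])

  line34 : Good ((0 ∷ 0 ∷ []) ∷ (2 ∷ 3 ∷ []) ∷ (-7 ∷ -12 ∷ []) ∷ (2 ∷ 3 ∷ []) ∷ [])
  line34 =
    move ((5 ∷ 8 ∷ []) ∷ (5 ∷ 8 ∷ []) ∷ (2 ∷ 3 ∷ []) ∷ (3 ∷ 5 ∷ []) ∷ [])
      (never 8 ∷ never 8 ∷ never 3 ∷ never 5 ∷ [])

  plane7 : Good ((0 ∷ 0 ∷ 0 ∷ []) ∷ (2 ∷ 3 ∷ 0 ∷ []) ∷ (2 ∷ 0 ∷ 3 ∷ []) ∷ (-7 ∷ -9 ∷ -3 ∷ []) ∷ [])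
  plane7 =
    move ((5 ∷ 7 ∷ 1 ∷ []) ∷ (5 ∷ 4 ∷ 4 ∷ []) ∷ (2 ∷ 3 ∷ 0 ∷ []) ∷ (3 ∷ 4 ∷ 1 ∷ []) ∷ [])
      ( via line33 ((0 ∷ 1 ∷ 0 ∷ []) ∷ []) 1 (-108 ∷ -216 ∷ 54 ∷ [])
      ∷ never 4
      ∷ never 3
      ∷ via line34 ((0 ∷ 1 ∷ 0 ∷ []) ∷ []) 1 (0 ∷ -54 ∷ 54 ∷ [])
      ∷ [])

  -- Families with three parameters: one index is zero

  -- The three remaining indices are 2 modulo 3 and sum to 6 plus three times the last parameter,
  -- which is why it was chosen: its parity is that of the index sum. Denominator 2 works in the
  -- even case, denominator 6 in the odd one.
  space1 : Good ((0 ∷ 0 ∷ 0 ∷ 0 ∷ []) ∷ (2 ∷ 3 ∷ 0 ∷ 0 ∷ []) ∷ (2 ∷ 0 ∷ 3 ∷ 0 ∷ []) ∷ (2 ∷ -3 ∷ -3 ∷ 3 ∷ []) ∷ [])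
  space1 =
    split (suc (suc zero)) 2
      ( move ((3 ∷ 0 ∷ 0 ∷ 3 ∷ []) ∷ (1 ∷ -3 ∷ 0 ∷ 3 ∷ []) ∷ (1 ∷ 0 ∷ -3 ∷ 3 ∷ []) ∷ (1 ∷ 3 ∷ 3 ∷ -3 ∷ []) ∷ [])
          ( via plane5 ((0 ∷ 1 ∷ 0 ∷ 0 ∷ []) ∷ (0 ∷ 0 ∷ 1 ∷ 0 ∷ []) ∷ []) 1 (-14 ∷ -36 ∷ -36 ∷ 36 ∷ [])
          ∷ never 3
          ∷ never 3
          ∷ never 3
          ∷ [])
      , move ((-1 ∷ 4 ∷ 1 ∷ -3 ∷ []) ∷ (-1 ∷ 1 ∷ 4 ∷ -3 ∷ []) ∷ (-4 ∷ 0 ∷ 0 ∷ -3 ∷ []) ∷ (-3 ∷ 1 ∷ 1 ∷ -3 ∷ []) ∷ [])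
          ( via plane6 ((0 ∷ 1 ∷ 0 ∷ 0 ∷ []) ∷ (0 ∷ -2 ∷ 0 ∷ 1 ∷ []) ∷ []) 1 (0 ∷ -162 ∷ 54 ∷ 54 ∷ [])
          ∷ via plane6 ((0 ∷ 0 ∷ 1 ∷ 0 ∷ []) ∷ (0 ∷ 0 ∷ -2 ∷ 1 ∷ []) ∷ []) 1 (0 ∷ 54 ∷ -162 ∷ 54 ∷ [])
          ∷ never 3
          ∷ via plane7 ((-2 ∷ 0 ∷ 0 ∷ -1 ∷ []) ∷ (0 ∷ 1 ∷ 0 ∷ 0 ∷ []) ∷ []) 1 (108 ∷ 0 ∷ 54 ∷ 54 ∷ [])
          ∷ [])
      , _)

  -- Reflect the zero together with two indices x, y whose sum is not 1 modulo 3; such a pair exists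
  -- unless all three indices are 2 modulo 3. If the sum is 0 modulo 3, a new index vanishes only
  -- for x = -y (`plane2`), x = 2 y or y = 2 x (`plane3`). If it is 2, this happens only for x = 2 y
  -- - 1 or y = 2 x - 1 (`plane4`). The index left alone may also vanish (`plane1`).
  space2 : Good ((0 ∷ 0 ∷ 0 ∷ 0 ∷ []) ∷ (0 ∷ 1 ∷ 0 ∷ 0 ∷ []) ∷ (0 ∷ 0 ∷ 1 ∷ 0 ∷ []) ∷ (0 ∷ 0 ∷ 0 ∷ 1 ∷ []) ∷ [])
  space2 =
    split zero 3
      ( split (suc zero) 3
          ( move ((0 ∷ 0 ∷ 0 ∷ 1 ∷ []) ∷ (0 ∷ 2 ∷ 2 ∷ 0 ∷ []) ∷ (0 ∷ -1 ∷ 2 ∷ 0 ∷ []) ∷ (0 ∷ 2 ∷ -1 ∷ 0 ∷ []) ∷ [])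
              ( via plane1 ((0 ∷ 3 ∷ 0 ∷ 0 ∷ []) ∷ (0 ∷ 0 ∷ 3 ∷ 0 ∷ []) ∷ []) 1 (-1 ∷ 0 ∷ 0 ∷ 3 ∷ [])
              ∷ via plane2 ((0 ∷ 3 ∷ 0 ∷ 0 ∷ []) ∷ (0 ∷ 0 ∷ 0 ∷ 1 ∷ []) ∷ []) 2 (-3 ∷ -27 ∷ 27 ∷ 0 ∷ [])
              ∷ via plane3 ((0 ∷ 0 ∷ 0 ∷ 1 ∷ []) ∷ (0 ∷ 0 ∷ 3 ∷ 0 ∷ []) ∷ []) 1 (3 ∷ -27 ∷ -54 ∷ 0 ∷ [])
              ∷ via plane3 ((0 ∷ 0 ∷ 0 ∷ 1 ∷ []) ∷ (0 ∷ 3 ∷ 0 ∷ 0 ∷ []) ∷ []) 1 (3 ∷ -54 ∷ -27 ∷ 0 ∷ [])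
              ∷ [])
          , split (suc (suc zero)) 3
              ( move ((1 ∷ 0 ∷ 3 ∷ 0 ∷ []) ∷ (0 ∷ 2 ∷ 0 ∷ 2 ∷ []) ∷ (0 ∷ -1 ∷ 0 ∷ 2 ∷ []) ∷ (0 ∷ 2 ∷ 0 ∷ -1 ∷ []) ∷ [])
                  ( never 3
                  ∷ via plane2 ((0 ∷ 3 ∷ 0 ∷ 0 ∷ []) ∷ (1 ∷ 0 ∷ 3 ∷ 0 ∷ []) ∷ []) 2 (-3 ∷ -27 ∷ 0 ∷ 27 ∷ [])
                  ∷ via plane3 ((1 ∷ 0 ∷ 3 ∷ 0 ∷ []) ∷ (0 ∷ 0 ∷ 0 ∷ 3 ∷ []) ∷ []) 1 (3 ∷ -27 ∷ 0 ∷ -54 ∷ [])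
                  ∷ via plane3 ((1 ∷ 0 ∷ 3 ∷ 0 ∷ []) ∷ (0 ∷ 3 ∷ 0 ∷ 0 ∷ []) ∷ []) 1 (3 ∷ -54 ∷ 0 ∷ -27 ∷ [])
                  ∷ [])
              , move ((0 ∷ 3 ∷ 0 ∷ 0 ∷ []) ∷ (-1 ∷ 0 ∷ -2 ∷ -2 ∷ []) ∷ (0 ∷ 0 ∷ 1 ∷ -2 ∷ []) ∷ (0 ∷ 0 ∷ -2 ∷ 1 ∷ []) ∷ [])
                  ( via plane1 ((1 ∷ 0 ∷ 3 ∷ 0 ∷ []) ∷ (1 ∷ 0 ∷ 0 ∷ 3 ∷ []) ∷ []) 1 (-1 ∷ 9 ∷ 0 ∷ 0 ∷ [])
                  ∷ never 2
                  ∷ via plane4 ((0 ∷ 3 ∷ 0 ∷ 0 ∷ []) ∷ (1 ∷ 0 ∷ 0 ∷ 3 ∷ []) ∷ []) 1 (15 ∷ 0 ∷ 27 ∷ 54 ∷ [])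
                  ∷ via plane4 ((0 ∷ 3 ∷ 0 ∷ 0 ∷ []) ∷ (1 ∷ 0 ∷ 3 ∷ 0 ∷ []) ∷ []) 1 (15 ∷ 0 ∷ 54 ∷ 27 ∷ [])
                  ∷ [])
              , move ((1 ∷ 0 ∷ 3 ∷ 0 ∷ []) ∷ (-1 ∷ -2 ∷ 0 ∷ -2 ∷ []) ∷ (-1 ∷ 1 ∷ 0 ∷ -2 ∷ []) ∷ (1 ∷ -2 ∷ 0 ∷ 1 ∷ []) ∷ [])
                  ( never 3
                  ∷ never 2
                  ∷ via plane4 ((1 ∷ 0 ∷ 3 ∷ 0 ∷ []) ∷ (2 ∷ 0 ∷ 0 ∷ 3 ∷ []) ∷ []) 1 (24 ∷ 27 ∷ 0 ∷ 54 ∷ [])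
                  ∷ via plane4 ((1 ∷ 0 ∷ 3 ∷ 0 ∷ []) ∷ (0 ∷ 3 ∷ 0 ∷ 0 ∷ []) ∷ []) 1 (6 ∷ 54 ∷ 0 ∷ 27 ∷ [])
                  ∷ [])
              , _)
          , move ((0 ∷ 0 ∷ 0 ∷ 1 ∷ []) ∷ (-1 ∷ -2 ∷ -2 ∷ 0 ∷ []) ∷ (-1 ∷ 1 ∷ -2 ∷ 0 ∷ []) ∷ (1 ∷ -2 ∷ 1 ∷ 0 ∷ []) ∷ [])
              ( via plane1 ((0 ∷ 3 ∷ 0 ∷ 0 ∷ []) ∷ (2 ∷ 0 ∷ 3 ∷ 0 ∷ []) ∷ []) 1 (-1 ∷ 0 ∷ 0 ∷ 3 ∷ [])
              ∷ never 2
              ∷ via plane4 ((0 ∷ 0 ∷ 0 ∷ 1 ∷ []) ∷ (2 ∷ 0 ∷ 3 ∷ 0 ∷ []) ∷ []) 1 (24 ∷ 27 ∷ 54 ∷ 0 ∷ [])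
              ∷ via plane4 ((0 ∷ 0 ∷ 0 ∷ 1 ∷ []) ∷ (0 ∷ 3 ∷ 0 ∷ 0 ∷ []) ∷ []) 1 (6 ∷ 54 ∷ 27 ∷ 0 ∷ [])
              ∷ [])
          , _)
      , split (suc zero) 3
          ( split (suc (suc zero)) 3
              ( move ((1 ∷ 3 ∷ 0 ∷ 0 ∷ []) ∷ (0 ∷ 0 ∷ 2 ∷ 2 ∷ []) ∷ (0 ∷ 0 ∷ -1 ∷ 2 ∷ []) ∷ (0 ∷ 0 ∷ 2 ∷ -1 ∷ []) ∷ [])
                  ( never 3
                  ∷ via plane2 ((0 ∷ 0 ∷ 3 ∷ 0 ∷ []) ∷ (1 ∷ 3 ∷ 0 ∷ 0 ∷ []) ∷ []) 2 (-3 ∷ 0 ∷ -27 ∷ 27 ∷ [])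
                  ∷ via plane3 ((1 ∷ 3 ∷ 0 ∷ 0 ∷ []) ∷ (0 ∷ 0 ∷ 0 ∷ 3 ∷ []) ∷ []) 1 (3 ∷ 0 ∷ -27 ∷ -54 ∷ [])
                  ∷ via plane3 ((1 ∷ 3 ∷ 0 ∷ 0 ∷ []) ∷ (0 ∷ 0 ∷ 3 ∷ 0 ∷ []) ∷ []) 1 (3 ∷ 0 ∷ -54 ∷ -27 ∷ [])
                  ∷ [])
              , move ((0 ∷ 0 ∷ 3 ∷ 0 ∷ []) ∷ (-1 ∷ -2 ∷ 0 ∷ -2 ∷ []) ∷ (0 ∷ 1 ∷ 0 ∷ -2 ∷ []) ∷ (0 ∷ -2 ∷ 0 ∷ 1 ∷ []) ∷ [])
                  ( via plane1 ((1 ∷ 3 ∷ 0 ∷ 0 ∷ []) ∷ (1 ∷ 0 ∷ 0 ∷ 3 ∷ []) ∷ []) 1 (-1 ∷ 0 ∷ 9 ∷ 0 ∷ [])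
                  ∷ never 2
                  ∷ via plane4 ((0 ∷ 0 ∷ 3 ∷ 0 ∷ []) ∷ (1 ∷ 0 ∷ 0 ∷ 3 ∷ []) ∷ []) 1 (15 ∷ 27 ∷ 0 ∷ 54 ∷ [])
                  ∷ via plane4 ((0 ∷ 0 ∷ 3 ∷ 0 ∷ []) ∷ (1 ∷ 3 ∷ 0 ∷ 0 ∷ []) ∷ []) 1 (15 ∷ 54 ∷ 0 ∷ 27 ∷ [])
                  ∷ [])
              , move ((1 ∷ 3 ∷ 0 ∷ 0 ∷ []) ∷ (-1 ∷ 0 ∷ -2 ∷ -2 ∷ []) ∷ (-1 ∷ 0 ∷ 1 ∷ -2 ∷ []) ∷ (1 ∷ 0 ∷ -2 ∷ 1 ∷ []) ∷ [])
                  ( never 3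
                  ∷ never 2
                  ∷ via plane4 ((1 ∷ 3 ∷ 0 ∷ 0 ∷ []) ∷ (2 ∷ 0 ∷ 0 ∷ 3 ∷ []) ∷ []) 1 (24 ∷ 0 ∷ 27 ∷ 54 ∷ [])
                  ∷ via plane4 ((1 ∷ 3 ∷ 0 ∷ 0 ∷ []) ∷ (0 ∷ 0 ∷ 3 ∷ 0 ∷ []) ∷ []) 1 (6 ∷ 0 ∷ 54 ∷ 27 ∷ [])
                  ∷ [])
              , _)
          , move ((0 ∷ 0 ∷ 0 ∷ 1 ∷ []) ∷ (-1 ∷ -2 ∷ -2 ∷ 0 ∷ []) ∷ (0 ∷ 1 ∷ -2 ∷ 0 ∷ []) ∷ (0 ∷ -2 ∷ 1 ∷ 0 ∷ []) ∷ [])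
              ( via plane1 ((1 ∷ 3 ∷ 0 ∷ 0 ∷ []) ∷ (1 ∷ 0 ∷ 3 ∷ 0 ∷ []) ∷ []) 1 (-1 ∷ 0 ∷ 0 ∷ 3 ∷ [])
              ∷ never 2
              ∷ via plane4 ((0 ∷ 0 ∷ 0 ∷ 1 ∷ []) ∷ (1 ∷ 0 ∷ 3 ∷ 0 ∷ []) ∷ []) 1 (15 ∷ 27 ∷ 54 ∷ 0 ∷ [])
              ∷ via plane4 ((0 ∷ 0 ∷ 0 ∷ 1 ∷ []) ∷ (1 ∷ 3 ∷ 0 ∷ 0 ∷ []) ∷ []) 1 (15 ∷ 54 ∷ 27 ∷ 0 ∷ [])
              ∷ [])
          , move ((0 ∷ 0 ∷ 0 ∷ 1 ∷ []) ∷ (2 ∷ 2 ∷ 2 ∷ 0 ∷ []) ∷ (1 ∷ -1 ∷ 2 ∷ 0 ∷ []) ∷ (0 ∷ 2 ∷ -1 ∷ 0 ∷ []) ∷ [])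
              ( via plane1 ((1 ∷ 3 ∷ 0 ∷ 0 ∷ []) ∷ (2 ∷ 0 ∷ 3 ∷ 0 ∷ []) ∷ []) 1 (-1 ∷ 0 ∷ 0 ∷ 3 ∷ [])
              ∷ via plane2 ((1 ∷ 3 ∷ 0 ∷ 0 ∷ []) ∷ (0 ∷ 0 ∷ 0 ∷ 1 ∷ []) ∷ []) 2 (6 ∷ -27 ∷ 27 ∷ 0 ∷ [])
              ∷ via plane3 ((0 ∷ 0 ∷ 0 ∷ 1 ∷ []) ∷ (2 ∷ 0 ∷ 3 ∷ 0 ∷ []) ∷ []) 1 (-42 ∷ -27 ∷ -54 ∷ 0 ∷ [])
              ∷ via plane3 ((0 ∷ 0 ∷ 0 ∷ 1 ∷ []) ∷ (1 ∷ 3 ∷ 0 ∷ 0 ∷ []) ∷ []) 1 (-33 ∷ -54 ∷ -27 ∷ 0 ∷ [])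
              ∷ [])
          , _)
      , split (suc zero) 3
          ( move ((0 ∷ 0 ∷ 0 ∷ 1 ∷ []) ∷ (-1 ∷ -2 ∷ -2 ∷ 0 ∷ []) ∷ (1 ∷ 1 ∷ -2 ∷ 0 ∷ []) ∷ (-1 ∷ -2 ∷ 1 ∷ 0 ∷ []) ∷ [])
              ( via plane1 ((2 ∷ 3 ∷ 0 ∷ 0 ∷ []) ∷ (0 ∷ 0 ∷ 3 ∷ 0 ∷ []) ∷ []) 1 (-1 ∷ 0 ∷ 0 ∷ 3 ∷ [])
              ∷ never 2
              ∷ via plane4 ((0 ∷ 0 ∷ 0 ∷ 1 ∷ []) ∷ (0 ∷ 0 ∷ 3 ∷ 0 ∷ []) ∷ []) 1 (6 ∷ 27 ∷ 54 ∷ 0 ∷ [])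
              ∷ via plane4 ((0 ∷ 0 ∷ 0 ∷ 1 ∷ []) ∷ (2 ∷ 3 ∷ 0 ∷ 0 ∷ []) ∷ []) 1 (24 ∷ 54 ∷ 27 ∷ 0 ∷ [])
              ∷ [])
          , move ((0 ∷ 0 ∷ 0 ∷ 1 ∷ []) ∷ (2 ∷ 2 ∷ 2 ∷ 0 ∷ []) ∷ (0 ∷ -1 ∷ 2 ∷ 0 ∷ []) ∷ (1 ∷ 2 ∷ -1 ∷ 0 ∷ []) ∷ [])
              ( via plane1 ((2 ∷ 3 ∷ 0 ∷ 0 ∷ []) ∷ (1 ∷ 0 ∷ 3 ∷ 0 ∷ []) ∷ []) 1 (-1 ∷ 0 ∷ 0 ∷ 3 ∷ [])
              ∷ via plane2 ((2 ∷ 3 ∷ 0 ∷ 0 ∷ []) ∷ (0 ∷ 0 ∷ 0 ∷ 1 ∷ []) ∷ []) 2 (-12 ∷ -27 ∷ 27 ∷ 0 ∷ [])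
              ∷ via plane3 ((0 ∷ 0 ∷ 0 ∷ 1 ∷ []) ∷ (1 ∷ 0 ∷ 3 ∷ 0 ∷ []) ∷ []) 1 (-33 ∷ -27 ∷ -54 ∷ 0 ∷ [])
              ∷ via plane3 ((0 ∷ 0 ∷ 0 ∷ 1 ∷ []) ∷ (2 ∷ 3 ∷ 0 ∷ 0 ∷ []) ∷ []) 1 (-42 ∷ -54 ∷ -27 ∷ 0 ∷ [])
              ∷ [])
          , split (suc (suc zero)) 3
              ( move ((2 ∷ 0 ∷ 3 ∷ 0 ∷ []) ∷ (-1 ∷ -2 ∷ 0 ∷ -2 ∷ []) ∷ (1 ∷ 1 ∷ 0 ∷ -2 ∷ []) ∷ (-1 ∷ -2 ∷ 0 ∷ 1 ∷ []) ∷ [])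
                  ( never 3
                  ∷ never 2
                  ∷ via plane4 ((2 ∷ 0 ∷ 3 ∷ 0 ∷ []) ∷ (0 ∷ 0 ∷ 0 ∷ 3 ∷ []) ∷ []) 1 (6 ∷ 27 ∷ 0 ∷ 54 ∷ [])
                  ∷ via plane4 ((2 ∷ 0 ∷ 3 ∷ 0 ∷ []) ∷ (2 ∷ 3 ∷ 0 ∷ 0 ∷ []) ∷ []) 1 (24 ∷ 54 ∷ 0 ∷ 27 ∷ [])
                  ∷ [])
              , move ((2 ∷ 0 ∷ 3 ∷ 0 ∷ []) ∷ (2 ∷ 2 ∷ 0 ∷ 2 ∷ []) ∷ (0 ∷ -1 ∷ 0 ∷ 2 ∷ []) ∷ (1 ∷ 2 ∷ 0 ∷ -1 ∷ []) ∷ [])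
                  ( never 3
                  ∷ via plane2 ((2 ∷ 3 ∷ 0 ∷ 0 ∷ []) ∷ (2 ∷ 0 ∷ 3 ∷ 0 ∷ []) ∷ []) 2 (-12 ∷ -27 ∷ 0 ∷ 27 ∷ [])
                  ∷ via plane3 ((2 ∷ 0 ∷ 3 ∷ 0 ∷ []) ∷ (1 ∷ 0 ∷ 0 ∷ 3 ∷ []) ∷ []) 1 (-33 ∷ -27 ∷ 0 ∷ -54 ∷ [])
                  ∷ via plane3 ((2 ∷ 0 ∷ 3 ∷ 0 ∷ []) ∷ (2 ∷ 3 ∷ 0 ∷ 0 ∷ []) ∷ []) 1 (-42 ∷ -54 ∷ 0 ∷ -27 ∷ [])
                  ∷ [])
              -- No pair is admissible here, as 2 + 2 is 1 modulo 3. The third parameter is replaced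
              -- by the sum of all three, to be split by parity.
              , reduce space1 ((0 ∷ 1 ∷ 0 ∷ 0 ∷ []) ∷ (0 ∷ 0 ∷ 1 ∷ 0 ∷ []) ∷ (0 ∷ 1 ∷ 1 ∷ 1 ∷ []) ∷ [])
              , _)
          , _)
      , _)

  -- The family of all quadruples of indices

  rootFamily : Family 4
  rootFamily =
    (0 ∷ 1 ∷ 0 ∷ 0 ∷ 0 ∷ []) ∷ (0 ∷ 0 ∷ 1 ∷ 0 ∷ 0 ∷ []) ∷ (0 ∷ 0 ∷ 0 ∷ 1 ∷ 0 ∷ []) ∷ (0 ∷ 0 ∷ 0 ∷ 0 ∷ 1 ∷ []) ∷ []

  -- The identity serves as the transformation: a quadruple without zeros is its own witness, and a
  -- vanishing index leaves the other three as parameters of `space2`. The cofactor is `3 t - 1`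
  -- because `pent₂ t = t (3 t - 1)`.
  root : Good rootFamily
  root =
    move rootFamily
      ( via space2 ((0 ∷ 0 ∷ 1 ∷ 0 ∷ 0 ∷ []) ∷ (0 ∷ 0 ∷ 0 ∷ 1 ∷ 0 ∷ []) ∷ (0 ∷ 0 ∷ 0 ∷ 0 ∷ 1 ∷ []) ∷ []) 1 (-1 ∷ 3 ∷ 0 ∷ 0 ∷ 0 ∷ [])
      ∷ via space2 ((0 ∷ 1 ∷ 0 ∷ 0 ∷ 0 ∷ []) ∷ (0 ∷ 0 ∷ 0 ∷ 1 ∷ 0 ∷ []) ∷ (0 ∷ 0 ∷ 0 ∷ 0 ∷ 1 ∷ []) ∷ []) 1 (-1 ∷ 0 ∷ 3 ∷ 0 ∷ 0 ∷ [])
      ∷ via space2 ((0 ∷ 1 ∷ 0 ∷ 0 ∷ 0 ∷ []) ∷ (0 ∷ 0 ∷ 1 ∷ 0 ∷ 0 ∷ []) ∷ (0 ∷ 0 ∷ 0 ∷ 0 ∷ 1 ∷ []) ∷ []) 1 (-1 ∷ 0 ∷ 0 ∷ 3 ∷ 0 ∷ [])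
      ∷ via space2 ((0 ∷ 1 ∷ 0 ∷ 0 ∷ 0 ∷ []) ∷ (0 ∷ 0 ∷ 1 ∷ 0 ∷ 0 ∷ []) ∷ (0 ∷ 0 ∷ 0 ∷ 1 ∷ 0 ∷ []) ∷ []) 1 (-1 ∷ 0 ∷ 0 ∷ 0 ∷ 3 ∷ [])
      ∷ [])

open Reduction using (rootFamily; root)

root-at : ∀ x y z w → rootFamily at (x ∷ y ∷ z ∷ w ∷ []) ≡ x ∷ y ∷ z ∷ w ∷ []
root-at x y z w = cong₂ _∷_ (eq₁ x y z w) (cong₂ _∷_ (eq₂ x y z w) (cong₂ _∷_ (eq₃ x y z w) (cong (_∷ []) (eq₄ x y z w))))
  where
  eq₁ : ∀ x y z w → 0ℤ * 1ℤ + (1ℤ * x + (0ℤ * y + (0ℤ * z + (0ℤ * w + 0ℤ)))) ≡ x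
  eq₁ = solve-∀
  eq₂ : ∀ x y z w → 0ℤ * 1ℤ + (0ℤ * x + (1ℤ * y + (0ℤ * z + (0ℤ * w + 0ℤ)))) ≡ y
  eq₂ = solve-∀
  eq₃ : ∀ x y z w → 0ℤ * 1ℤ + (0ℤ * x + (0ℤ * y + (1ℤ * z + (0ℤ * w + 0ℤ)))) ≡ z
  eq₃ = solve-∀
  eq₄ : ∀ x y z w → 0ℤ * 1ℤ + (0ℤ * x + (0ℤ * y + (0ℤ * z + (1ℤ * w + 0ℤ)))) ≡ w
  eq₄ = solve-∀

all-represented : (ts : Vec ℤ 4) → Represented (Σpent₂ ts)
all-represented ts@(x ∷ y ∷ z ∷ w ∷ []) =
  subst Represented (cong Σpent₂ (root-at x y z w)) (Good.represented root ts)

-- Generalized pentagonal numbers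

-- Integer division rounds, so remainder 1 has to be excluded; it would make 1 even.
half-exact : ∀ E w → E ≡ w + w → E /ℕ 2 + E /ℕ 2 ≡ E
half-exact E w even with E %ℕ 2 | E /ℕ 2 | a≡a%ℕn+[a/ℕn]*n E 2 | n%ℕd<d E 2
... | 0 | q | eq | _ = trans (double q) (sym eq)
  where
  double : ∀ q → q + q ≡ 0ℤ + q * + 2
  double = solve-∀
... | 1 | q | eq | _ = ⊥-elim (from-no (+ 2 Signed.∣? 1ℤ) (Signed.divides (w - q) (begin
  1ℤ                         ≡⟨ isolate q ⟩
  1ℤ + q * + 2 - q * + 2     ≡⟨ cong (_- q * + 2) (trans (sym eq) even) ⟩
  w + w - q * + 2            ≡⟨ factor w q ⟩
  (w - q) * + 2              ∎)))
  where
  isolate : ∀ q → 1ℤ ≡ 1ℤ + q * + 2 - q * + 2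
  isolate = solve-∀
  factor : ∀ w q → w + w - q * + 2 ≡ (w - q) * + 2
  factor = solve-∀
... | suc (suc _) | _ | _ | s≤s (s≤s ())

P5-double : ∀ t → P5 t + P5 t ≡ pent₂ t
P5-double t with pronic-even t
... | T , T≡ = trans (half-exact (+ 3 * t * t - t) (t * t + T) even) (factor t)
  where
  split-off : ∀ t → + 3 * t * t - t ≡ t * t + t * t + (t * t - t)
  split-off = solve-∀
  regroup : ∀ s T → s + s + (T + T) ≡ s + T + (s + T)
  regroup = solve-∀
  even : + 3 * t * t - t ≡ t * t + T + (t * t + T)
  even = trans (split-off t) (trans (cong (λ z → t * t + t * t + z) T≡) (regroup (t * t) T))
  factor : ∀ t → + 3 * t * t - t ≡ t * (+ 3 * t - 1ℤ)
  factor = solve-∀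

sum-P5-double : ∀ {k} (ts : Vec ℤ k) → sumℤ (map P5 ts) + sumℤ (map P5 ts) ≡ Σpent₂ ts
sum-P5-double [] = refl
sum-P5-double (t ∷ ts) = trans (regroup (P5 t) (sumℤ (map P5 ts))) (cong₂ _+_ (P5-double t) (sum-P5-double ts))
  where
  regroup : ∀ x y → x + y + (x + y) ≡ x + x + (y + y)
  regroup = solve-∀

double-injective : ∀ {x y} → x + x ≡ y + y → x ≡ y
double-injective {x} {y} eq = ℤ.*-cancelˡ-≡ (+ 2) x y (trans (two x) (trans eq (sym (two y))))
  where
  two : ∀ x → + 2 * x ≡ x + x
  two = solve-∀

-- Existence for `k ≤ n` and the lower bound on sums of `k` terms

four-summands : ∀ n → 4 ≤ n → SumOfNonzeroGenPent 4 (+ n)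
four-summands n 4≤n = conclude (subst Represented (sym 2n≡) (all-represented ts) (ℤ.+≤+ (ℕ.+-mono-≤ 4≤n 4≤n)))
  where
  ts = proj₁ (sum-of-four n)
  2n≡ : + n + + n ≡ Σpent₂ ts
  2n≡ = proj₂ (sum-of-four n)
  conclude : (Σ (Vec ℤ 4) λ us → All (λ t → ¬ t ≡ 0ℤ) us × + n + + n ≡ Σpent₂ us) → SumOfNonzeroGenPent 4 (+ n)
  conclude (us , nonzero , eq) = us , nonzero , double-injective (trans eq (sym (sum-P5-double us)))

many-summands : ∀ j n → 4 ℕ.+ j ≤ n → SumOfNonzeroGenPent (4 ℕ.+ j) (+ n)
many-summands zero n 4≤n = four-summands n 4≤n
many-summands (suc j) (suc n) (s≤s le) with many-summands j n le
... | xs , nonzero , eq = 1ℤ ∷ xs , (λ ()) ∷ nonzero , cong (λ z → 1ℤ + z) eq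

double-positive : ∀ {k} y → y + y ≡ + suc k → 1ℤ ℤ.≤ y
double-positive (+ suc y) _ = ℤ.+≤+ (s≤s z≤n)

P5-positive : ∀ x → ¬ x ≡ 0ℤ → 1ℤ ℤ.≤ P5 x
P5-positive (+ zero) x≢0 = ⊥-elim (x≢0 refl)
P5-positive (+ suc m) _ = double-positive (P5 (+ suc m)) (begin
  P5 (+ suc m) + P5 (+ suc m)       ≡⟨ P5-double (+ suc m) ⟩
  pent₂ (1ℤ + + m)                  ≡⟨ expand (+ m) ⟩
  (1ℤ + + m) * (+ 2 + + 3 * + m)    ≡⟨ cong (λ z → + suc m * (+ 2 + z)) (ℤ.pos-* 3 m) ⟨
  + suc m * + (2 ℕ.+ 3 ℕ.* m)       ∎)
  where
  expand : ∀ m → (1ℤ + m) * (+ 3 * (1ℤ + m) - 1ℤ) ≡ (1ℤ + m) * (+ 2 + + 3 * m)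
  expand = solve-∀
P5-positive -[1+ m ] _ = double-positive (P5 -[1+ m ]) (begin
  P5 -[1+ m ] + P5 -[1+ m ]         ≡⟨ P5-double -[1+ m ] ⟩
  pent₂ (- (1ℤ + + m))              ≡⟨ expand (+ m) ⟩
  (1ℤ + + m) * (+ 4 + + 3 * + m)    ≡⟨ cong (λ z → + suc m * (+ 4 + z)) (ℤ.pos-* 3 m) ⟨
  + suc m * + (4 ℕ.+ 3 ℕ.* m)       ∎)
  where
  expand : ∀ m → - (1ℤ + m) * (+ 3 * - (1ℤ + m) - 1ℤ) ≡ (1ℤ + m) * (+ 4 + + 3 * m)
  expand = solve-∀

length≤sum : ∀ {k} {xs : Vec ℤ k} → All (λ x → ¬ x ≡ 0ℤ) xs → + k ℤ.≤ sumℤ (map P5 xs)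
length≤sum [] = ℤ.≤-refl
length≤sum {xs = x ∷ _} (x≢0 ∷ nonzero) = ℤ.+-mono-≤ (P5-positive x x≢0) (length≤sum nonzero)

theorem4p4 : (k : ℕ) → 4 ≤ k → (n : ℕ) → 1 ≤ n →
    (k ≤ n → SumOfNonzeroGenPent k (+ n)) × (n < k → ¬ SumOfNonzeroGenPent k (+ n))
theorem4p4 k 4≤k n _ =
    (λ k≤n → subst (λ k → SumOfNonzeroGenPent k (+ n)) 4+j≡k
      (many-summands (k ℕ.∸ 4) n (subst (_≤ n) (sym 4+j≡k) k≤n)))
  , λ { n<k (xs , nonzero , eq) →
      ℕ.<⇒≱ n<k (ℤ.drop‿+≤+ (subst (+ k ℤ.≤_) (sym eq) (length≤sum nonzero))) }
  where
  4+j≡k : 4 ℕ.+ (k ℕ.∸ 4) ≡ k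
  4+j≡k = ℕ.m+[n∸m]≡n 4≤k
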